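{- (ii) For every integer $r\ge 3$ and all sufficiently large $n$, $\mathrm{ex}_r(n,C_4)=e_r(F_n)$. (iii) For every integer $k>2$ and all sufficiently large $n$, $\mathrm{ex}_2(n,\{C_4,C_{2k}\})=e_2(F_n)$.
   Context: For a graph $G$ with degree sequence $d_1,\dots,d_n$, $e_r(G)=\sum_i d_i^r$. For a graph $F$ (or a family $\mathcal{F}$ of graphs), $\mathrm{ex}_r(n,F)$ (resp. $\mathrm{ex}_r(n,\mathcal{F})$) is the maximum of $e_r(G)$ over $n$-vertex graphs $G$ containing no copy of $F$ (resp. of any member of $\mathcal{F}$). $C_\ell$ is the cycle of length $\ell$. $F_n$ is the $n$-vertex graph consisting of a vertex of degree $n-1$ together with a largest possible matching on the remaining $n-1$ vertices. -}

module Defs where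

open import Data.Nat using (ℕ; zero; suc; _+_; _∸_; _^_; _≤_; _≡ᵇ_)
open import Data.Nat.DivMod using (_/_)
open import Data.Bool using (Bool; true; false; not; _∧_; _∨_; if_then_else_)
open import Data.Fin using (Fin; toℕ)
open import Data.List using (List; map; allFin)
open import Data.Nat.ListAction using (sum)
open import Data.Product using (Σ; ∃; _×_; _,_)
open import Data.Sum using (_⊎_)
open import Relation.Nullary using (¬_)
open import Relation.Binary.PropositionalEquality using (_≡_; refl)
open import Function.Definitions using (Injective)

record Graph (n : ℕ) : Set where
  field
    adj    : Fin n → Fin n → Bool
    sym    : ∀ i j → adj i j ≡ adj j i
    irrefl : ∀ i → adj i i ≡ false
open Graph public

Adj : ∀ {n} → Graph n → Fin n → Fin n → Set
Adj G i j = adj G i j ≡ true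

deg : ∀ {n} → Graph n → Fin n → ℕ
deg {n} G i = sum (map (λ j → if adj G i j then 1 else 0) (allFin n))

e : ℕ → ∀ {n} → Graph n → ℕ
e r {n} G = sum (map (λ i → deg G i ^ r) (allFin n))

ContainsCycle : ℕ → ∀ {n} → Graph n → Set
ContainsCycle ℓ {n} G =
  Σ (Fin ℓ → Fin n) λ f →
    Injective _≡_ _≡_ f ×
    (∀ (i j : Fin ℓ) →
       (suc (toℕ i) ≡ toℕ j ⊎ (suc (toℕ i) ≡ ℓ × toℕ j ≡ 0)) →
       Adj G (f i) (f j))

-- the cycle C_ℓ (ℓ ≥ 3) is meaningful only for ℓ ≥ 3; all uses below have ℓ ≥ 4.

IsMaxE : ℕ → (n : ℕ) → (Graph n → Set) → ℕ → Set
IsMaxE r n Free m =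
  (Σ (Graph n) λ G → Free G × e r G ≡ m) ×
  (∀ (G : Graph n) → Free G → e r G ≤ m)

-- The graph F_n: vertex 0 is joined to all others; vertices 1..n-1 carry
-- the matching {1,2},{3,4},… (a largest matching; if n-1 is odd the last
-- vertex is unmatched).
≡ᵇ-sym : ∀ a b → (a ≡ᵇ b) ≡ (b ≡ᵇ a)
≡ᵇ-sym zero zero = refl
≡ᵇ-sym zero (suc b) = refl
≡ᵇ-sym (suc a) zero = refl
≡ᵇ-sym (suc a) (suc b) = ≡ᵇ-sym a b

≡ᵇ-refl : ∀ a → (a ≡ᵇ a) ≡ true
≡ᵇ-refl zero = refl
≡ᵇ-refl (suc a) = ≡ᵇ-refl a

private
  ∨-swap : ∀ x y z → x ∨ (y ∨ z) ≡ y ∨ (x ∨ z)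
  ∨-swap false y z = refl
  ∨-swap true false z = refl
  ∨-swap true true z = refl

adjFℕ : ℕ → ℕ → Bool
adjFℕ a b = not (a ≡ᵇ b) ∧ ((a ≡ᵇ 0) ∨ ((b ≡ᵇ 0) ∨ (((a ∸ 1) / 2) ≡ᵇ ((b ∸ 1) / 2))))

adjFℕ-sym : ∀ a b → adjFℕ a b ≡ adjFℕ b a
adjFℕ-sym a b rewrite ≡ᵇ-sym a b | ≡ᵇ-sym ((a ∸ 1) / 2) ((b ∸ 1) / 2)
                    | ∨-swap (a ≡ᵇ 0) (b ≡ᵇ 0) (((b ∸ 1) / 2) ≡ᵇ ((a ∸ 1) / 2)) = refl

adjFℕ-irrefl : ∀ a → adjFℕ a a ≡ false
adjFℕ-irrefl a rewrite ≡ᵇ-refl a = refl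

F : (n : ℕ) → Graph n
F n = record
  { adj    = λ i j → adjFℕ (toℕ i) (toℕ j)
  ; sym    = λ i j → adjFℕ-sym (toℕ i) (toℕ j)
  ; irrefl = λ i → adjFℕ-irrefl (toℕ i)
  }

module Submission where

-- In a C₄-free graph two vertices have at most one common neighbour, so Σ deg² ≤ n² + Σ deg and Σ deg = o(n²).
-- Let v have maximum degree d and let S be the set of the s = n - 1 - d vertices outside its closed neighbourhood.
-- A vertex u ≠ v has at most 2 + |N(u) ∩ S| neighbours, and counting cherries with both ends in S gives
-- Σ (2 + |N(u) ∩ S|)² ≤ 4n + 11s². If s = 0, all other degrees are at most 2 and the handshake lemma settles the
-- parity of n. If s ≥ 1 is small, the term d^r loses at least s (n - 1)^(r - 1), which outweighs the rest. If s is
-- large, Σ deg^r ≤ d^(r-2) Σ deg² suffices for r ≥ 3.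
-- For r = 2 and s large, Σ deg² ≥ n² would force all but o(n²) pairs of vertices to have a common neighbour. A vertex
-- w of S reaches the x in N(v), apart from the bad(w) vertices having no common neighbour with w, through distinct
-- neighbours, so deg w ≥ d - bad(w). Summing over S bounds s d by o(n²), hence d = o(n), and C₂ₖ is built greedily: choose
-- x₁, …, xₖ with few bad partners so that cyclically consecutive ones have common neighbours, each time avoiding
-- the neighbourhoods of the vertices already used.

open import Defs
open import Data.Bool using (true; false; not; _∧_; T; if_then_else_)
open import Data.Empty using (⊥; ⊥-elim)
open import Data.Fin using (Fin; zero; suc; toℕ; fromℕ; fromℕ<)
open import Data.Fin.Patterns using (0F; 1F; 2F; 3F; 4F; 5F)
import Data.Fin.Properties as Fin
open import Data.List using (map; allFin; tabulate)
open import Data.List.Properties using (map-tabulate)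
open import Data.Nat using (ℕ; zero; suc; _+_; _*_; _^_; _∸_; _≡ᵇ_; _≤_; _<_; _≤?_; z≤n; s≤s; NonZero; >-nonZero)
open import Data.Nat.DivMod using (_/_; m/n≡1+[m∸n]/n)
import Data.Nat.ListAction as List
open import Data.Nat.Properties
open import Data.Nat.Tactic.RingSolver using (solve-∀)
open import Data.Product using (Σ; ∃; _×_; _,_; proj₁; proj₂)
open import Data.Sum using (_⊎_; inj₁; inj₂)
open import Data.Unit using (tt)
open import Data.Vec using (Vec; []; _∷_; lookup)
open import Data.Vec.Relation.Unary.All as All using (All; []; _∷_)
open import Data.Vec.Relation.Unary.AllPairs using ([]; _∷_)
open import Data.Vec.Relation.Unary.Unique.Propositional using (Unique)
open import Data.Vec.Relation.Unary.Unique.Propositional.Properties using (lookup-injective)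
open import Function using (_∘_; id)
open import Relation.Nullary using (¬_; Dec; yes; no; contradiction; ¬?; _×-dec_)
open import Relation.Binary.PropositionalEquality using (_≡_; _≢_; refl; trans; cong; cong₂; subst; subst₂; module ≡-Reasoning) renaming (sym to ≡-sym)
open import Algebra.Properties.Semiring.Sum +-*-semiring using (sum; sum-syntax; sum-cong-≗; ∑-distrib-+; ∑-comm; *-distribˡ-sum; *-distribʳ-sum; sum-replicate-zero)

-- Sums over Fin n

sumList≡∑ : ∀ {n} (f : Fin n → ℕ) → List.sum (map f (allFin n)) ≡ sum f
sumList≡∑ {n} f = trans (cong List.sum (map-tabulate id f)) (sum-tabulate f)
  where
  sum-tabulate : ∀ {m} (g : Fin m → ℕ) → List.sum (tabulate g) ≡ sum g
  sum-tabulate {zero}  g = refl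
  sum-tabulate {suc m} g = cong (g zero +_) (sum-tabulate (g ∘ suc))

∑-mono : ∀ {n} {f g : Fin n → ℕ} → (∀ i → f i ≤ g i) → sum f ≤ sum g
∑-mono {zero}  h = z≤n
∑-mono {suc n} h = +-mono-≤ (h zero) (∑-mono (h ∘ suc))

∑-const : ∀ n c → ∑[ i < n ] c ≡ n * c
∑-const zero    c = refl
∑-const (suc n) c = cong (c +_) (∑-const n c)

f≤∑f : ∀ {n} (f : Fin n → ℕ) i → f i ≤ sum f
f≤∑f f zero    = m≤m+n _ _
f≤∑f f (suc i) = ≤-trans (f≤∑f (f ∘ suc) i) (m≤n+m _ _)

-- Every nonzero term contributes at least 1. This is the selection principle of the greedy
-- construction: `f` counts the reasons for excluding a vertex, and a total below `n` leaves a
-- vertex with none.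
∑<n⇒∃0 : ∀ {n} (f : Fin n → ℕ) → sum f < n → ∃ λ i → f i ≡ 0
∑<n⇒∃0 {suc n} f lt with f zero in eq
... | zero  = zero , eq
... | suc m with ∑<n⇒∃0 (f ∘ suc) (≤-trans (s≤s (m≤n+m _ m)) (≤-pred lt))
...   | i , p = suc i , p

∑>0⇒∃>0 : ∀ {n} (f : Fin n → ℕ) → 0 < sum f → ∃ λ i → 0 < f i
∑>0⇒∃>0 {suc n} f lt with f zero in eq
... | suc m = zero , subst (0 <_) (≡-sym eq) (s≤s z≤n)
... | zero with ∑>0⇒∃>0 (f ∘ suc) lt
...   | i , p = suc i , p

∑≤1 : ∀ {n} (f : Fin n → ℕ) → (∀ i → f i ≤ 1) →
      (∀ i j → 0 < f i → 0 < f j → i ≡ j) → sum f ≤ 1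
∑≤1 {zero}  f h u = z≤n
∑≤1 {suc n} f h u with f zero in eq
... | zero  = ∑≤1 (f ∘ suc) (h ∘ suc) (λ i j p q → Fin.suc-injective (u (suc i) (suc j) p q))
... | suc m with sum (f ∘ suc) in eqs
...   | zero   = subst (λ k → k + 0 ≤ 1) eq (subst (_≤ 1) (≡-sym (+-identityʳ _)) (h zero))
...   | suc m′ with ∑>0⇒∃>0 (f ∘ suc) (subst (0 <_) (≡-sym eqs) (s≤s z≤n))
...     | i , p with u zero (suc i) (subst (0 <_) (≡-sym eq) (s≤s z≤n)) p
...       | ()

argmax : ∀ {n} (f : Fin (suc n) → ℕ) → ∃ λ v → ∀ u → f u ≤ f v
argmax {zero}  f = zero , λ { zero → ≤-refl }
argmax {suc n} f with argmax (f ∘ suc)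
... | v , h with ≤-total (f zero) (f (suc v))
...   | inj₁ le = suc v , λ { zero → le ; (suc u) → h u }
...   | inj₂ ge = zero  , λ { zero → ≤-refl ; (suc u) → ≤-trans (h u) ge }

-- The Kronecker delta with natural values. As a factor inside a sum it isolates one vertex, so that
-- estimates with an exceptional vertex can still be proved term by term.
δ : ∀ {n} → Fin n → Fin n → ℕ
δ zero    zero    = 1
δ zero    (suc j) = 0
δ (suc i) zero    = 0
δ (suc i) (suc j) = δ i j

δ-refl : ∀ {n} (i : Fin n) → δ i i ≡ 1
δ-refl zero    = refl
δ-refl (suc i) = δ-refl i

δ-≢ : ∀ {n} {i j : Fin n} → i ≢ j → δ i j ≡ 0
δ-≢ {i = zero}  {zero}  p = contradiction refl p
δ-≢ {i = zero}  {suc j} p = refl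
δ-≢ {i = suc i} {zero}  p = refl
δ-≢ {i = suc i} {suc j} p = δ-≢ (p ∘ cong suc)

δ≡0⇒≢ : ∀ {n} {i j : Fin n} → δ i j ≡ 0 → i ≢ j
δ≡0⇒≢ {i = i} p refl with trans (≡-sym (δ-refl i)) p
... | ()

∑-δ : ∀ {n} (i : Fin n) (f : Fin n → ℕ) → ∑[ j < n ] (δ i j * f j) ≡ f i
∑-δ {suc n} zero    f = trans (cong₂ _+_ (+-identityʳ _) (sum-replicate-zero n)) (+-identityʳ _)
∑-δ         (suc i) f = ∑-δ i (f ∘ suc)

∑-δ1 : ∀ {n} (i : Fin n) → ∑[ j < n ] δ i j ≡ 1
∑-δ1 i = trans (sum-cong-≗ (λ j → ≡-sym (*-identityʳ (δ i j)))) (∑-δ i (λ _ → 1))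

-- Induction on the vertices: by symmetry the row and the column of vertex `zero` have the same sum
-- `R`, so they add `R + R` to the total.
handshake : ∀ {n} (f : Fin n → Fin n → ℕ) → (∀ i j → f i j ≡ f j i) → (∀ i → f i i ≡ 0) →
            ∃ λ q → ∑[ i < n ] ∑[ j < n ] f i j ≡ q + q
handshake {zero}  f s z = 0 , refl
handshake {suc n} f s z with handshake (λ i j → f (suc i) (suc j)) (λ i j → s _ _) (λ i → z _)
... | q , eq = R + q , trans (cong₂ _+_ (cong (_+ R) (z zero))
                 (trans (∑-distrib-+ (λ i → f (suc i) zero) _)
                   (cong₂ _+_ (sum-cong-≗ (λ i → s (suc i) zero)) eq))) (lem R q)
  where
  R = ∑[ j < n ] f zero (suc j)
  lem : ∀ r q → (0 + r) + (r + (q + q)) ≡ (r + q) + (r + q)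
  lem = solve-∀

-- Degrees, codegrees and paths

module Adjacency {n} (G : Graph n) where

  a : Fin n → Fin n → ℕ
  a i j = if adj G i j then 1 else 0

  a-sym : ∀ i j → a i j ≡ a j i
  a-sym i j = cong (if_then 1 else 0) (Graph.sym G i j)

  a-irrefl : ∀ i → a i i ≡ 0
  a-irrefl i = cong (if_then 1 else 0) (irrefl G i)

  a≤1 : ∀ i j → a i j ≤ 1
  a≤1 i j with adj G i j
  ... | true  = ≤-refl
  ... | false = z≤n

  a*a≡a : ∀ i j → a i j * a i j ≡ a i j
  a*a≡a i j with adj G i j
  ... | true  = refl
  ... | false = refl

  Adj⇒a≡1 : ∀ {i j} → Adj G i j → a i j ≡ 1
  Adj⇒a≡1 = cong (if_then 1 else 0)

  Adj-sym : ∀ {i j} → Adj G i j → Adj G j i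
  Adj-sym {i} {j} = trans (Graph.sym G j i)

  Adj⇒≢ : ∀ {i j} → Adj G i j → i ≢ j
  Adj⇒≢ {i} p refl with trans (≡-sym p) (irrefl G i)
  ... | ()

  deg≡∑ : ∀ i → deg G i ≡ sum (a i)
  deg≡∑ i = sumList≡∑ (a i)

  D : ℕ
  D = ∑[ i < n ] deg G i

  e≡∑ : ∀ r → e r G ≡ ∑[ i < n ] (deg G i ^ r)
  e≡∑ r = sumList≡∑ (λ i → deg G i ^ r)

  D-even : ∃ λ q → D ≡ q + q
  D-even with handshake a a-sym a-irrefl
  ... | q , eq = q , trans (sum-cong-≗ deg≡∑) eq

  -- The number of common neighbours; on the diagonal it is the degree.
  codeg : Fin n → Fin n → ℕ
  codeg x y = ∑[ u < n ] (a u x * a u y)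

  codeg-diag : ∀ x → codeg x x ≡ deg G x
  codeg-diag x = trans (sum-cong-≗ (λ u → trans (a*a≡a u x) (a-sym u x))) (≡-sym (deg≡∑ x))

  common : ∀ {x y u} → 0 < a u x * a u y → Adj G u x × Adj G u y
  common {x} {y} {u} p with adj G u x | adj G u y
  ... | true  | true = refl , refl
  ... | false | _ with p
  ...   | ()
  common {x} {y} {u} () | true | false

  codeg>0⇒common : ∀ {x y} → 0 < codeg x y → ∃ λ u → Adj G u x × Adj G u y
  codeg>0⇒common p with ∑>0⇒∃>0 _ p
  ... | u , q = u , common q

  infixr 5 _∷⟨_,_⟩_

  -- Path x ys: ys lists the path from its most recently added vertex down to its initial vertex x.
  data Path (x : Fin n) : ∀ {m} → Vec (Fin n) (suc m) → Set where
    [-]      : Path x (x ∷ [])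
    _∷⟨_,_⟩_ : ∀ y {z m} {zs : Vec (Fin n) m} → Adj G y z → All (y ≢_) (z ∷ zs) →
               Path x (z ∷ zs) → Path x (y ∷ z ∷ zs)

  Path⇒Unique : ∀ {x m} {ys : Vec (Fin n) (suc m)} → Path x ys → Unique ys
  Path⇒Unique [-] = [] ∷ []
  Path⇒Unique (y ∷⟨ _ , p ⟩ P) = p ∷ Path⇒Unique P

  Path⇒All : ∀ {x m} {ys : Vec (Fin n) (suc m)} {Q : Fin n → Set} → All Q ys → Path x ys → Q x
  Path⇒All (q ∷ _)  [-] = q
  Path⇒All (_ ∷ qs) (y ∷⟨ _ , _ ⟩ P) = Path⇒All qs P

  Path-start≢end : ∀ {x h m} {ys : Vec (Fin n) (suc m)} → Path x (h ∷ ys) → h ≢ x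
  Path-start≢end (_ ∷⟨ _ , h∉ ⟩ P) = Path⇒All h∉ P

  Path-step : ∀ {x m} {ys : Vec (Fin n) (suc m)} → Path x ys → ∀ i j →
              suc (toℕ i) ≡ toℕ j → Adj G (lookup ys i) (lookup ys j)
  Path-step [-] zero zero ()
  Path-step (y ∷⟨ p , _ ⟩ P) zero (suc zero) _ = p
  Path-step (y ∷⟨ p , _ ⟩ P) (suc i) (suc j) q = Path-step P i j (suc-injective q)

  Path-end : ∀ {x m} {ys : Vec (Fin n) (suc m)} → Path x ys → ∀ i → toℕ i ≡ m → lookup ys i ≡ x
  Path-end [-] zero q = refl
  Path-end (y ∷⟨ _ , _ ⟩ P) (suc i) q = Path-end P i (suc-injective q)

  -- The last entry of the vector is `x`, so the edge from `x` to `y` is the one that the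
  -- wrap-around clause of `ContainsCycle` asks for.
  closedPath : ∀ {x y m} {ys : Vec (Fin n) m} → Path x (y ∷ ys) → Adj G x y → ContainsCycle (suc m) G
  closedPath {x} {y} {m} {ys} P xy = lookup (y ∷ ys) , lookup-injective (Path⇒Unique P) _ _ , edge
    where
    edge : ∀ (i j : Fin (suc m)) → (suc (toℕ i) ≡ toℕ j ⊎ (suc (toℕ i) ≡ suc m × toℕ j ≡ 0)) →
           Adj G (lookup (y ∷ ys) i) (lookup (y ∷ ys) j)
    edge i j    (inj₁ q) = Path-step P i j q
    edge i zero (inj₂ (q , _)) = subst (λ z → Adj G z y) (≡-sym (Path-end P i (suc-injective q))) xy

-- Counting cherries in a C₄-free graph

module C₄-free {n} (G : Graph n) (free : ¬ ContainsCycle 4 G) where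

  open Adjacency G public

  -- Otherwise `x`, `u`, `y`, `w` form a 4-cycle.
  common-unique : ∀ {x y u w} → x ≢ y → Adj G u x → Adj G u y → Adj G w x → Adj G w y → u ≡ w
  common-unique {x} {y} {u} {w} x≢y ux uy wx wy with u Fin.≟ w
  ... | yes p = p
  ... | no u≢w = ⊥-elim (free (closedPath
        (x ∷⟨ Adj-sym ux , Adj⇒≢ (Adj-sym ux) ∷ x≢y ∷ Adj⇒≢ (Adj-sym wx) ∷ [] ⟩
         u ∷⟨ uy , Adj⇒≢ uy ∷ u≢w ∷ [] ⟩
         y ∷⟨ Adj-sym wy , Adj⇒≢ (Adj-sym wy) ∷ [] ⟩ [-]) wx))

  codeg≤1 : ∀ {x y} → x ≢ y → codeg x y ≤ 1
  codeg≤1 {x} {y} x≢y = ∑≤1 _ (λ u → *-mono-≤ (a≤1 u x) (a≤1 u y))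
    (λ u w p q → common-unique x≢y (proj₁ (common p)) (proj₂ (common p)) (proj₁ (common q)) (proj₂ (common q)))

  -- The `δ` term takes care of the diagonal, so that the bound can be summed over all ordered pairs
  -- at once.
  codeg≤ : ∀ x y → codeg x y ≤ 1 + δ x y * deg G x
  codeg≤ x y with x Fin.≟ y
  ... | no  x≢y  = ≤-trans (codeg≤1 x≢y) (m≤m+n 1 _)
  ... | yes refl = ≤-trans (≤-reflexive (trans (codeg-diag x)
                     (trans (≡-sym (*-identityˡ _)) (cong (_* deg G x) (≡-sym (δ-refl x)))))) (n≤1+n _)

  -- Double counting: the square at `u` counts ordered pairs of neighbours of `u` weighted by `σ`.
  -- Exchanging the sums groups these pairs by their ends instead of their centre.
  square-sum : ∀ (σ : Fin n → ℕ) → ∑[ u < n ] (∑[ x < n ] (a u x * σ x) * ∑[ x < n ] (a u x * σ x))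
               ≡ ∑[ x < n ] ∑[ y < n ] (σ x * σ y * codeg x y)
  square-sum σ = begin
    ∑[ u < n ] (sum (h u) * sum (h u))                  ≡⟨ sum-cong-≗ (λ u → trans (*-distribʳ-sum (sum (h u)) (h u))
                                                            (sum-cong-≗ (λ x → *-distribˡ-sum (h u x) (h u)))) ⟩
    ∑[ u < n ] ∑[ x < n ] ∑[ y < n ] (h u x * h u y)    ≡⟨ ∑-comm {n} {n} (λ u x → ∑[ y < n ] (h u x * h u y)) ⟩
    ∑[ x < n ] ∑[ u < n ] ∑[ y < n ] (h u x * h u y)    ≡⟨ sum-cong-≗ (λ x → ∑-comm {n} {n} (λ u y → h u x * h u y)) ⟩
    ∑[ x < n ] ∑[ y < n ] ∑[ u < n ] (h u x * h u y)    ≡⟨ sum-cong-≗ (λ x → sum-cong-≗ (λ y → trans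
                                                            (sum-cong-≗ (λ u → lem (a u x) (σ x) (a u y) (σ y)))
                                                            (≡-sym (*-distribˡ-sum (σ x * σ y) (λ u → a u x * a u y))))) ⟩
    ∑[ x < n ] ∑[ y < n ] (σ x * σ y * codeg x y)       ∎
    where
    open ≡-Reasoning
    h : Fin n → Fin n → ℕ
    h u x = a u x * σ x
    lem : ∀ p q r s → (p * q) * (r * s) ≡ (q * s) * (p * r)
    lem = solve-∀

  -- The left side counts cherries with both ends in σ, and two distinct ends determine the centre.
  square-sum≤ : ∀ (σ : Fin n → ℕ) → (∀ x → σ x ≤ 1) →
                ∑[ u < n ] (∑[ x < n ] (a u x * σ x) * ∑[ x < n ] (a u x * σ x))
                ≤ sum σ * sum σ + ∑[ x < n ] (σ x * deg G x)
  square-sum≤ σ σ≤1 = begin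
    ∑[ u < n ] (∑[ x < n ] (a u x * σ x) * ∑[ x < n ] (a u x * σ x))   ≡⟨ square-sum σ ⟩
    ∑[ x < n ] ∑[ y < n ] (σ x * σ y * codeg x y)                       ≤⟨ ∑-mono row ⟩
    ∑[ x < n ] (σ x * sum σ + σ x * deg G x)                            ≡⟨ ∑-distrib-+ (λ x → σ x * sum σ) _ ⟩
    ∑[ x < n ] (σ x * sum σ) + ∑[ x < n ] (σ x * deg G x)               ≡⟨ cong₂ _+_ (≡-sym (*-distribʳ-sum (sum σ) σ)) refl ⟩
    sum σ * sum σ + ∑[ x < n ] (σ x * deg G x)                          ∎
    where
    open ≤-Reasoning
    lem : ∀ p q r s → p * q * (1 + r * s) ≡ p * q + r * (p * q * s)
    lem = solve-∀
    row : ∀ x → ∑[ y < n ] (σ x * σ y * codeg x y) ≤ σ x * sum σ + σ x * deg G x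
    row x = begin
      ∑[ y < n ] (σ x * σ y * codeg x y)                                ≤⟨ ∑-mono (λ y → ≤-trans (*-monoʳ-≤ (σ x * σ y) (codeg≤ x y))
                                                                             (≤-reflexive (lem (σ x) (σ y) (δ x y) (deg G x)))) ⟩
      ∑[ y < n ] (σ x * σ y + δ x y * (σ x * σ y * deg G x))            ≡⟨ ∑-distrib-+ (λ y → σ x * σ y) _ ⟩
      ∑[ y < n ] (σ x * σ y) + ∑[ y < n ] (δ x y * (σ x * σ y * deg G x)) ≡⟨ cong₂ _+_ (≡-sym (*-distribˡ-sum (σ x) σ))
                                                                               (∑-δ x (λ y → σ x * σ y * deg G x)) ⟩
      σ x * sum σ + σ x * σ x * deg G x                                 ≤⟨ +-monoʳ-≤ (σ x * sum σ) (*-monoˡ-≤ (deg G x)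
                                                                             (≤-trans (*-monoʳ-≤ (σ x) (σ≤1 x)) (≤-reflexive (*-identityʳ (σ x))))) ⟩
      σ x * sum σ + σ x * deg G x                                       ∎

  ∑deg²≤ : ∑[ u < n ] (deg G u * deg G u) ≤ n * n + D
  ∑deg²≤ = subst₂ _≤_ (sum-cong-≗ (λ u → cong₂ _*_ (eq u) (eq u)))
             (cong₂ _+_ (cong₂ _*_ eq1 eq1) (sum-cong-≗ (λ x → +-identityʳ (deg G x))))
             (square-sum≤ (λ _ → 1) (λ _ → ≤-refl))
    where
    eq1 : ∑[ x < n ] 1 ≡ n
    eq1 = trans (∑-const n 1) (*-identityʳ n)
    eq : ∀ u → ∑[ x < n ] (a u x * 1) ≡ deg G u
    eq u = trans (sum-cong-≗ (λ x → *-identityʳ (a u x))) (≡-sym (deg≡∑ u))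

  -- Sums 2Kq ≤ q² + K² over the degrees q. Combined with `∑deg²≤` it gives (2K - 1) D ≤ n² + nK²,
  -- so the degree sum is small compared with n² for a suitable `K`.
  D-small : ∀ K → (K + K) * D ≤ ∑[ u < n ] (deg G u * deg G u) + n * (K * K)
  D-small K = begin
    (K + K) * D                                        ≡⟨ *-distribˡ-sum (K + K) (deg G) ⟩
    ∑[ u < n ] ((K + K) * deg G u)                     ≤⟨ ∑-mono (λ u → am-gm K (deg G u)) ⟩
    ∑[ u < n ] (deg G u * deg G u + K * K)             ≡⟨ ∑-distrib-+ (λ u → deg G u * deg G u) _ ⟩
    ∑[ u < n ] (deg G u * deg G u) + ∑[ u < n ] (K * K) ≡⟨ cong (∑[ u < n ] (deg G u * deg G u) +_) (∑-const n (K * K)) ⟩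
    ∑[ u < n ] (deg G u * deg G u) + n * (K * K)       ∎
    where
    open ≤-Reasoning
    lem : ∀ p t → (p + p) * (p + t) + t * t ≡ (p + t) * (p + t) + p * p
    lem = solve-∀
    lem′ : ∀ p t → ((p + t) + (p + t)) * p + t * t ≡ p * p + (p + t) * (p + t)
    lem′ = solve-∀
    am-gm : ∀ p q → (p + p) * q ≤ q * q + p * p
    am-gm p q with ≤-total p q
    ... | inj₁ le with m≤n⇒∃[o]m+o≡n le
    ...   | t , refl = ≤-trans (m≤m+n _ (t * t)) (≤-reflexive (lem p t))
    am-gm p q | inj₂ ge with m≤n⇒∃[o]m+o≡n ge
    ...   | t , refl = ≤-trans (m≤m+n _ (t * t)) (≤-reflexive (lem′ q t))

-- The neighbourhood of a vertex, and pairs without common neighbour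

module Neighbourhood {n} (G : Graph n) (free : ¬ ContainsCycle 4 G) (v : Fin n) where

  open C₄-free G free

  private
    δ+a≤1 : ∀ x → δ v x + a v x ≤ 1
    δ+a≤1 x with v Fin.≟ x
    ... | yes refl = ≤-reflexive (cong₂ _+_ (δ-refl v) (a-irrefl v))
    ... | no v≢x   = subst (_≤ 1) (cong (_+ a v x) (≡-sym (δ-≢ v≢x))) (a≤1 v x)

  -- The indicator of the set S of vertices outside the closed neighbourhood of v.
  σ : Fin n → ℕ
  σ x = 1 ∸ (δ v x + a v x)

  s : ℕ
  s = sum σ

  degS : Fin n → ℕ
  degS u = ∑[ x < n ] (a u x * σ x)

  σ≤1 : ∀ x → σ x ≤ 1
  σ≤1 x = m∸n≤m 1 (δ v x + a v x)

  partition : ∀ x → (δ v x + a v x) + σ x ≡ 1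
  partition x = m+[n∸m]≡n (δ+a≤1 x)

  n≡1+deg+s : n ≡ 1 + deg G v + s
  n≡1+deg+s = begin
    n                                              ≡⟨ ≡-sym (trans (∑-const n 1) (*-identityʳ n)) ⟩
    ∑[ x < n ] 1                                   ≡⟨ sum-cong-≗ (λ x → ≡-sym (partition x)) ⟩
    ∑[ x < n ] ((δ v x + a v x) + σ x)             ≡⟨ ∑-distrib-+ (λ x → δ v x + a v x) σ ⟩
    ∑[ x < n ] (δ v x + a v x) + s                 ≡⟨ cong (_+ s) (∑-distrib-+ (δ v) (a v)) ⟩
    sum (δ v) + sum (a v) + s                      ≡⟨ cong (_+ s) (cong₂ _+_ (∑-δ1 v) (≡-sym (deg≡∑ v))) ⟩
    1 + deg G v + s                                ∎
    where open ≡-Reasoning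

  -- A neighbour of `u` is either `v` itself, or a neighbour of `v` and hence common to both, or a
  -- member of S.
  deg-split : ∀ u → deg G u ≡ a u v + codeg u v + degS u
  deg-split u = begin
    deg G u                                                             ≡⟨ deg≡∑ u ⟩
    sum (a u)                                                           ≡⟨ sum-cong-≗ point ⟩
    ∑[ x < n ] (δ v x * a u x + a x u * a x v + a u x * σ x)            ≡⟨ ∑-distrib-+ (λ x → δ v x * a u x + a x u * a x v) _ ⟩
    ∑[ x < n ] (δ v x * a u x + a x u * a x v) + degS u                 ≡⟨ cong (_+ degS u) (∑-distrib-+ (λ x → δ v x * a u x) _) ⟩
    ∑[ x < n ] (δ v x * a u x) + codeg u v + degS u                     ≡⟨ cong (λ k → k + codeg u v + degS u) (∑-δ v (a u)) ⟩
    a u v + codeg u v + degS u                                          ∎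
    where
    open ≡-Reasoning
    lem : ∀ p q r t → p * ((q + r) + t) ≡ q * p + p * r + p * t
    lem = solve-∀
    point : ∀ x → a u x ≡ δ v x * a u x + a x u * a x v + a u x * σ x
    point x = begin
      a u x                                             ≡⟨ ≡-sym (*-identityʳ (a u x)) ⟩
      a u x * 1                                         ≡⟨ cong (a u x *_) (≡-sym (partition x)) ⟩
      a u x * ((δ v x + a v x) + σ x)                   ≡⟨ lem (a u x) (δ v x) (a v x) (σ x) ⟩
      δ v x * a u x + a u x * a v x + a u x * σ x       ≡⟨ cong (λ k → δ v x * a u x + k + a u x * σ x)
                                                             (cong₂ _*_ (a-sym u x) (a-sym v x)) ⟩
      δ v x * a u x + a x u * a x v + a u x * σ x       ∎

  degS≤s : ∀ u → degS u ≤ s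
  degS≤s u = ∑-mono (λ x → ≤-trans (*-monoˡ-≤ (σ x) (a≤1 u x)) (≤-reflexive (*-identityˡ (σ x))))

  deg≤2+degS : ∀ {u} → u ≢ v → deg G u ≤ 2 + degS u
  deg≤2+degS {u} u≢v = ≤-trans (≤-reflexive (deg-split u))
    (+-monoˡ-≤ (degS u) (+-mono-≤ (a≤1 u v) (codeg≤1 u≢v)))

  σ>0⇒≢ : ∀ {x} → 0 < σ x → x ≢ v
  σ>0⇒≢ {x} p refl with subst (λ k → 0 < 1 ∸ k) (cong₂ _+_ (δ-refl v) (a-irrefl v)) p
  ... | ()

  σ>0⇒a≡0 : ∀ {x} → 0 < σ x → a v x ≡ 0
  σ>0⇒a≡0 {x} p with a v x | δ v x
  ... | zero  | _ = refl
  ... | suc k | l with subst (λ j → 0 < 1 ∸ j) (+-suc l k) p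
  ...   | q with subst (0 <_) (0∸n≡0 (l + k)) q
  ...     | ()

  -- A vertex of S is not adjacent to `v` and shares at most one neighbour with it; all its other
  -- neighbours lie in S.
  σ*deg≤ : ∀ x → σ x * deg G x ≤ σ x * (1 + s)
  σ*deg≤ x with σ x in eq
  ... | zero  = z≤n
  ... | suc k = *-monoʳ-≤ (suc k) (≤-trans (≤-reflexive (trans (deg-split x)
                  (cong (λ j → j + codeg x v + degS x) (trans (a-sym x v) (σ>0⇒a≡0 pos)))))
                  (+-mono-≤ (codeg≤1 (σ>0⇒≢ pos)) (degS≤s x)))
    where
    pos : 0 < σ x
    pos = subst (0 <_) (≡-sym eq) (s≤s z≤n)

  ∑σ*deg≤ : ∑[ x < n ] (σ x * deg G x) ≤ s * (1 + s)
  ∑σ*deg≤ = ≤-trans (∑-mono σ*deg≤) (≤-reflexive (≡-sym (*-distribʳ-sum (1 + s) σ)))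

  ∑degS : sum degS ≡ ∑[ x < n ] (σ x * deg G x)
  ∑degS = trans (∑-comm {n} {n} (λ u x → a u x * σ x)) (sum-cong-≗ (λ x →
    trans (sum-cong-≗ (λ u → trans (*-comm (a u x) (σ x)) (cong (σ x *_) (a-sym u x))))
          (trans (≡-sym (*-distribˡ-sum (σ x) (a x))) (cong (σ x *_) (≡-sym (deg≡∑ x))))))

  Q : ℕ
  Q = ∑[ u < n ] ((2 + degS u) * (2 + degS u))

  -- After expanding the square, the linear part is 4 times the sum `W` of the degrees over S, and
  -- `square-sum≤` bounds the quadratic part by s² + `W`. Finally `W` is at most s(1 + s).
  Q≤ : Q ≤ n * 4 + 5 * (s * (1 + s)) + s * s
  Q≤ = begin
    ∑[ u < n ] ((2 + degS u) * (2 + degS u))                     ≡⟨ sum-cong-≗ (λ u → expand (degS u)) ⟩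
    ∑[ u < n ] (4 + 4 * degS u + degS u * degS u)                ≡⟨ ∑-distrib-+ (λ u → 4 + 4 * degS u) _ ⟩
    ∑[ u < n ] (4 + 4 * degS u) + X                              ≡⟨ cong (_+ X) (∑-distrib-+ (λ (_ : Fin n) → 4) _) ⟩
    ∑[ u < n ] 4 + ∑[ u < n ] (4 * degS u) + X                   ≡⟨ cong (_+ X) (cong₂ _+_ (∑-const n 4) (trans (≡-sym (*-distribˡ-sum 4 degS)) (cong (4 *_) ∑degS))) ⟩
    n * 4 + 4 * W + X                                            ≤⟨ +-monoʳ-≤ (n * 4 + 4 * W) (square-sum≤ σ σ≤1) ⟩
    n * 4 + 4 * W + (s * s + W)                                  ≡⟨ collect (n * 4) W (s * s) ⟩
    n * 4 + 5 * W + s * s                                        ≤⟨ +-monoˡ-≤ (s * s) (+-monoʳ-≤ (n * 4) (*-monoʳ-≤ 5 ∑σ*deg≤)) ⟩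
    n * 4 + 5 * (s * (1 + s)) + s * s                            ∎
    where
    open ≤-Reasoning
    X W : ℕ
    X = ∑[ u < n ] (degS u * degS u)
    W = ∑[ x < n ] (σ x * deg G x)
    expand : ∀ t → (2 + t) * (2 + t) ≡ 4 + 4 * t + t * t
    expand = solve-∀
    collect : ∀ p t q → p + 4 * t + (q + t) ≡ p + 5 * t + q
    collect = solve-∀

  -- The bound `deg≤2+degS` holds away from `v`, whose power is charged to the separate term. The
  -- sum still runs over all vertices, so that for r = 2 it is `Q`.
  e≤ : ∀ r → e r G ≤ deg G v ^ r + ∑[ u < n ] ((2 + degS u) ^ r)
  e≤ r = begin
    e r G                                                                   ≡⟨ e≡∑ r ⟩
    ∑[ u < n ] (deg G u ^ r)                                                ≤⟨ ∑-mono point ⟩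
    ∑[ u < n ] (δ v u * deg G u ^ r + (2 + degS u) ^ r)                     ≡⟨ ∑-distrib-+ (λ u → δ v u * deg G u ^ r) _ ⟩
    ∑[ u < n ] (δ v u * deg G u ^ r) + ∑[ u < n ] ((2 + degS u) ^ r)        ≡⟨ cong (_+ ∑[ u < n ] ((2 + degS u) ^ r)) (∑-δ v (λ u → deg G u ^ r)) ⟩
    deg G v ^ r + ∑[ u < n ] ((2 + degS u) ^ r)                             ∎
    where
    open ≤-Reasoning
    point : ∀ u → deg G u ^ r ≤ δ v u * deg G u ^ r + (2 + degS u) ^ r
    point u with u Fin.≟ v
    ... | no u≢v   = ≤-trans (^-monoˡ-≤ r (deg≤2+degS u≢v)) (m≤n+m _ _)
    ... | yes refl = ≤-trans (≤-reflexive (≡-sym (trans (cong (_* deg G u ^ r) (δ-refl u)) (*-identityˡ _)))) (m≤m+n _ _)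

module Deficiency {n} (G : Graph n) (free : ¬ ContainsCycle 4 G) where

  open C₄-free G free

  -- Truncated subtraction makes this the indicator of having no common neighbour; `b x` below
  -- counts the bad partners of `x`.
  bad : Fin n → Fin n → ℕ
  bad x y = 1 ∸ codeg x y

  b : Fin n → ℕ
  b x = sum (bad x)

  codeg+bad≥1 : ∀ x y → 1 ≤ codeg x y + bad x y
  codeg+bad≥1 x y = m≤n+m∸n 1 (codeg x y)

  codeg+bad≤ : ∀ x y → codeg x y + bad x y ≤ 1 + δ x y * deg G x
  codeg+bad≤ x y with codeg x y in eq
  ... | zero  = m≤m+n 1 _
  ... | suc k = ≤-trans (≤-reflexive (trans (cong (suc k +_) (0∸n≡0 k)) (trans (+-identityʳ _) (≡-sym eq)))) (codeg≤ x y)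

  -- The squared degrees add up to the codegrees of all ordered pairs. An off-diagonal pair has
  -- either codegree 1 or is bad, so both sums together use each such pair at most once, and the
  -- diagonal costs at most `D` more. If the squares reach n², at most `D` bad pairs remain.
  ∑b≤ : ∑[ u < n ] (deg G u * deg G u) + sum b ≤ n * n + D
  ∑b≤ = begin
    ∑[ u < n ] (deg G u * deg G u) + sum b                       ≡⟨ cong (_+ sum b) (trans (sum-cong-≗ (λ u → cong₂ _*_ (eq u) (eq u))) (square-sum (λ _ → 1))) ⟩
    ∑[ x < n ] ∑[ y < n ] (1 * 1 * codeg x y) + sum b            ≡⟨ cong (_+ sum b) (sum-cong-≗ (λ x → sum-cong-≗ (λ y → +-identityʳ (codeg x y)))) ⟩
    ∑[ x < n ] ∑[ y < n ] codeg x y + sum b                      ≡⟨ ≡-sym (∑-distrib-+ (λ x → sum (codeg x)) b) ⟩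
    ∑[ x < n ] (sum (codeg x) + sum (bad x))                     ≡⟨ sum-cong-≗ (λ x → ≡-sym (∑-distrib-+ (codeg x) (bad x))) ⟩
    ∑[ x < n ] ∑[ y < n ] (codeg x y + bad x y)                  ≤⟨ ∑-mono (λ x → ∑-mono (codeg+bad≤ x)) ⟩
    ∑[ x < n ] ∑[ y < n ] (1 + δ x y * deg G x)                  ≡⟨ sum-cong-≗ (λ x → trans (∑-distrib-+ (λ _ → 1) (λ y → δ x y * deg G x))
                                                                      (cong₂ _+_ (trans (∑-const n 1) (*-identityʳ n)) (∑-δ x (λ _ → deg G x)))) ⟩
    ∑[ x < n ] (n + deg G x)                                     ≡⟨ ∑-distrib-+ (λ _ → n) (deg G) ⟩
    ∑[ x < n ] n + D                                             ≡⟨ cong (_+ D) (∑-const n n) ⟩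
    n * n + D                                                    ∎
    where
    open ≤-Reasoning
    eq : ∀ u → deg G u ≡ ∑[ x < n ] (a u x * 1)
    eq u = ≡-sym (trans (sum-cong-≗ (λ x → *-identityʳ (a u x))) (≡-sym (deg≡∑ u)))

  module _ (v : Fin n) where

    open Neighbourhood G free v using (σ; s; σ≤1; σ>0⇒a≡0)

    -- A neighbour `x` of `v` is bad for `w` or is joined to `w` through some `c`. Here `c` differs
    -- from `v`, because `w` is not adjacent to `v`; hence `c` and `v` have at most one common
    -- neighbour, and distinct `x` need distinct `c`.
    deg≤deg+b : ∀ {w} → 0 < σ w → deg G v ≤ deg G w + b w
    deg≤deg+b {w} pos = begin
      deg G v                                                                ≡⟨ deg≡∑ v ⟩
      sum (a v)                                                              ≤⟨ ∑-mono point ⟩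
      ∑[ x < n ] (a v x * codeg w x + bad w x)                               ≡⟨ ∑-distrib-+ (λ x → a v x * codeg w x) (bad w) ⟩
      ∑[ x < n ] (a v x * codeg w x) + b w                                   ≡⟨ cong (_+ b w) swap ⟩
      ∑[ c < n ] (a c w * codeg v c) + b w                                   ≤⟨ +-monoˡ-≤ (b w) (∑-mono once) ⟩
      sum (a w) + b w                                                        ≡⟨ cong (_+ b w) (≡-sym (deg≡∑ w)) ⟩
      deg G w + b w                                                          ∎
      where
      open ≤-Reasoning
      point : ∀ x → a v x ≤ a v x * codeg w x + bad w x
      point x = ≤-trans (≤-reflexive (≡-sym (*-identityʳ (a v x))))
        (≤-trans (*-monoʳ-≤ (a v x) (codeg+bad≥1 w x))
        (≤-trans (≤-reflexive (*-distribˡ-+ (a v x) (codeg w x) (bad w x)))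
          (+-monoʳ-≤ (a v x * codeg w x) (≤-trans (*-monoˡ-≤ (bad w x) (a≤1 v x)) (≤-reflexive (*-identityˡ (bad w x)))))))
      lem : ∀ p q r → p * (q * r) ≡ q * (p * r)
      lem = solve-∀
      swap : ∑[ x < n ] (a v x * codeg w x) ≡ ∑[ c < n ] (a c w * codeg v c)
      swap = begin-equality
        ∑[ x < n ] (a v x * codeg w x)                           ≡⟨ sum-cong-≗ (λ x → *-distribˡ-sum (a v x) (λ c → a c w * a c x)) ⟩
        ∑[ x < n ] ∑[ c < n ] (a v x * (a c w * a c x))          ≡⟨ ∑-comm {n} {n} (λ x c → a v x * (a c w * a c x)) ⟩
        ∑[ c < n ] ∑[ x < n ] (a v x * (a c w * a c x))          ≡⟨ sum-cong-≗ (λ c → sum-cong-≗ (λ x → trans (lem (a v x) (a c w) (a c x))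
                                                                       (cong (a c w *_) (cong₂ _*_ (a-sym v x) (a-sym c x))))) ⟩
        ∑[ c < n ] ∑[ x < n ] (a c w * (a x v * a x c))          ≡⟨ sum-cong-≗ (λ c → ≡-sym (*-distribˡ-sum (a c w) (λ x → a x v * a x c))) ⟩
        ∑[ c < n ] (a c w * codeg v c)                           ∎
      once : ∀ c → a c w * codeg v c ≤ a w c
      once c with v Fin.≟ c
      ... | yes refl = ≤-trans (≤-reflexive (cong (_* codeg v c) (σ>0⇒a≡0 pos))) z≤n
      ... | no v≢c   = ≤-trans (*-monoʳ-≤ (a c w) (codeg≤1 v≢c)) (≤-reflexive (trans (*-identityʳ (a c w)) (a-sym c w)))

    s*deg≤ : s * deg G v ≤ D + sum b
    s*deg≤ = begin
      s * deg G v                          ≡⟨ *-distribʳ-sum (deg G v) σ ⟩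
      ∑[ w < n ] (σ w * deg G v)           ≤⟨ ∑-mono point ⟩
      ∑[ w < n ] (deg G w + b w)           ≡⟨ ∑-distrib-+ (deg G) b ⟩
      D + sum b                            ∎
      where
      open ≤-Reasoning
      point : ∀ w → σ w * deg G v ≤ deg G w + b w
      point w with σ w in eq
      ... | zero  = z≤n
      ... | suc k = ≤-trans (*-monoˡ-≤ (deg G v) (subst (_≤ 1) eq (σ≤1 w)))
                      (≤-trans (≤-reflexive (*-identityˡ (deg G v))) (deg≤deg+b (subst (0 <_) (≡-sym eq) (s≤s z≤n))))

-- The graph F n

-- With the hub removed, index `i` stands for vertex `suc i`, and the matching of `F` joins indices
-- with equal halves: 2j with 2j + 1.
mate : ℕ → ℕ
mate zero          = 1
mate (suc zero)    = 0
mate (suc (suc i)) = suc (suc (mate i))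

mate-≢ : ∀ i → i ≢ mate i
mate-≢ zero          ()
mate-≢ (suc zero)    ()
mate-≢ (suc (suc i)) p = mate-≢ i (suc-injective (suc-injective p))

2+i/2 : ∀ i → (2 + i) / 2 ≡ suc (i / 2)
2+i/2 i = m/n≡1+[m∸n]/n {2 + i} {2} (s≤s (s≤s z≤n))

mate-/2 : ∀ i → i / 2 ≡ mate i / 2
mate-/2 zero          = refl
mate-/2 (suc zero)    = refl
mate-/2 (suc (suc i)) = trans (2+i/2 i) (trans (cong suc (mate-/2 i)) (≡-sym (2+i/2 (mate i))))

mate-< : ∀ m i → i < m * 2 → mate i < m * 2
mate-< (suc m) zero          p = s≤s (s≤s z≤n)
mate-< (suc m) (suc zero)    p = s≤s z≤n
mate-< (suc m) (suc (suc i)) (s≤s (s≤s p)) = s≤s (s≤s (mate-< m i p))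

/2-≡⇒mate : ∀ i j → i / 2 ≡ j / 2 → i ≢ j → j ≡ mate i
/2-≡⇒mate zero          zero          p q = contradiction refl q
/2-≡⇒mate zero          (suc zero)    p q = refl
/2-≡⇒mate (suc zero)    zero          p q = refl
/2-≡⇒mate (suc zero)    (suc zero)    p q = contradiction refl q
/2-≡⇒mate zero          (suc (suc j)) p q with trans p (2+i/2 j)
... | ()
/2-≡⇒mate (suc zero)    (suc (suc j)) p q with trans p (2+i/2 j)
... | ()
/2-≡⇒mate (suc (suc i)) zero          p q with trans (≡-sym p) (2+i/2 i)
... | ()
/2-≡⇒mate (suc (suc i)) (suc zero)    p q with trans (≡-sym p) (2+i/2 i)
... | ()
/2-≡⇒mate (suc (suc i)) (suc (suc j)) p q = cong (2 +_) (/2-≡⇒mate i j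
  (suc-injective (trans (≡-sym (2+i/2 i)) (trans p (2+i/2 j)))) (q ∘ cong (2 +_)))

≡ᵇ-≢ : ∀ {i j} → i ≢ j → (i ≡ᵇ j) ≡ false
≡ᵇ-≢ {i} {j} p with i ≡ᵇ j in eq
... | false = refl
... | true  = contradiction (≡ᵇ⇒≡ i j (subst T (≡-sym eq) tt)) p

module Friendship (M : ℕ) where

  open Adjacency (F (suc M))

  F-Adj⇒mate : ∀ {i j : Fin M} → Adj (F (suc M)) (suc i) (suc j) → toℕ j ≡ mate (toℕ i)
  F-Adj⇒mate {i} {j} p with toℕ i ≡ᵇ toℕ j in neq | toℕ i / 2 ≡ᵇ toℕ j / 2 in eq
  ... | false | true = /2-≡⇒mate (toℕ i) (toℕ j) (≡ᵇ⇒≡ _ _ (subst T (≡-sym eq) tt))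
                         (λ i≡j → subst T (trans (≡-sym (trans (cong (_≡ᵇ toℕ j) i≡j) (≡ᵇ-refl (toℕ j)))) neq) tt)
  F-Adj⇒mate {i} {j} () | false | false
  F-Adj⇒mate {i} {j} () | true | _

  F-mate-Adj : ∀ {i j : Fin M} → toℕ j ≡ mate (toℕ i) → Adj (F (suc M)) (suc i) (suc j)
  F-mate-Adj {i} {j} p = cong₂ (λ x y → not x ∧ y)
    (≡ᵇ-≢ (λ q → mate-≢ (toℕ i) (trans q p)))
    (trans (cong (_≡ᵇ toℕ j / 2) (trans (mate-/2 (toℕ i)) (cong (_/ 2) (≡-sym p)))) (≡ᵇ-refl (toℕ j / 2)))

  -- Away from the hub all edges belong to the matching, so `y` cannot have two neighbours there.
  F-path-hits-0 : ∀ {x y z : Fin (suc M)} → Adj (F (suc M)) x y → Adj (F (suc M)) y z → x ≢ z →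
                  x ≡ zero ⊎ y ≡ zero ⊎ z ≡ zero
  F-path-hits-0 {zero}                  xy yz x≢z = inj₁ refl
  F-path-hits-0 {suc x} {zero}          xy yz x≢z = inj₂ (inj₁ refl)
  F-path-hits-0 {suc x} {suc y} {zero}  xy yz x≢z = inj₂ (inj₂ refl)
  F-path-hits-0 {suc x} {suc y} {suc z} xy yz x≢z = contradiction
    (cong suc (Fin.toℕ-injective (trans (F-Adj⇒mate {y} {x} (Adj-sym {suc x} {suc y} xy)) (≡-sym (F-Adj⇒mate {y} {z} yz))))) x≢z

  module Cycle {ℓ} (cyc : ContainsCycle ℓ (F (suc M))) where

    f : Fin ℓ → Fin (suc M)
    f = proj₁ cyc

    inj : ∀ {i j} → f i ≡ f j → i ≡ j
    inj = proj₁ (proj₂ cyc)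

    Step : Fin ℓ → Fin ℓ → Set
    Step i j = suc (toℕ i) ≡ toℕ j ⊎ (suc (toℕ i) ≡ ℓ × toℕ j ≡ 0)

    hits : ∀ {i j k} → Step i j → Step j k → i ≢ k → f i ≡ zero ⊎ f j ≡ zero ⊎ f k ≡ zero
    hits ij jk i≢k = F-path-hits-0 (proj₂ (proj₂ cyc) _ _ ij) (proj₂ (proj₂ cyc) _ _ jk) (i≢k ∘ inj)

    avoids : ∀ {i j k p} → f p ≡ zero → Step i j → Step j k → i ≢ k → p ≢ i → p ≢ j → p ≢ k → ⊥
    avoids fp ij jk i≢k p≢i p≢j p≢k with hits ij jk i≢k
    ... | inj₁ q        = p≢i (inj (trans fp (≡-sym q)))
    ... | inj₂ (inj₁ q) = p≢j (inj (trans fp (≡-sym q)))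
    ... | inj₂ (inj₂ q) = p≢k (inj (trans fp (≡-sym q)))

  -- One of the positions 0, 1, 2 is the hub; the three other positions are consecutive on the cycle
  -- and would have to contain the hub again.
  F-C₄-free : ¬ ContainsCycle 4 (F (suc M))
  F-C₄-free cyc with Cycle.hits cyc {0F} {1F} {2F} (inj₁ refl) (inj₁ refl) (λ ())
  ... | inj₁ p        = Cycle.avoids cyc {1F} {2F} {3F} p (inj₁ refl) (inj₁ refl) (λ ()) (λ ()) (λ ()) (λ ())
  ... | inj₂ (inj₁ p) = Cycle.avoids cyc {2F} {3F} {0F} p (inj₁ refl) (inj₂ (refl , refl)) (λ ()) (λ ()) (λ ()) (λ ())
  ... | inj₂ (inj₂ p) = Cycle.avoids cyc {3F} {0F} {1F} p (inj₂ (refl , refl)) (inj₁ refl) (λ ()) (λ ()) (λ ()) (λ ())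

  -- With at least six positions, 0, 1, 2 and 3, 4, 5 are disjoint runs, and each would have to
  -- contain the hub.
  F-C₆₊-free : ∀ ℓ → ¬ ContainsCycle (6 + ℓ) (F (suc M))
  F-C₆₊-free ℓ cyc with Cycle.hits cyc {0F} {1F} {2F} (inj₁ refl) (inj₁ refl) (λ ())
  ... | inj₁ p        = Cycle.avoids cyc {3F} {4F} {5F} p (inj₁ refl) (inj₁ refl) (λ ()) (λ ()) (λ ()) (λ ())
  ... | inj₂ (inj₁ p) = Cycle.avoids cyc {3F} {4F} {5F} p (inj₁ refl) (inj₁ refl) (λ ()) (λ ()) (λ ()) (λ ())
  ... | inj₂ (inj₂ p) = Cycle.avoids cyc {3F} {4F} {5F} p (inj₁ refl) (inj₁ refl) (λ ()) (λ ()) (λ ()) (λ ())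

  deg-F-0 : deg (F (suc M)) zero ≡ M
  deg-F-0 = trans (deg≡∑ zero) (trans (∑-const M 1) (*-identityʳ M))

  deg-F≥1 : ∀ i → 1 ≤ deg (F (suc M)) (suc i)
  deg-F≥1 i = subst (1 ≤_) (≡-sym (deg≡∑ (suc i))) (f≤∑f (a (suc i)) zero)

  deg-F≥2 : ∀ i → mate (toℕ i) < M → 2 ≤ deg (F (suc M)) (suc i)
  deg-F≥2 i lt = subst (2 ≤_) (≡-sym (deg≡∑ (suc i))) (s≤s
    (subst (_≤ ∑[ j < M ] a (suc i) (suc j)) (Adj⇒a≡1 {suc i} {suc (fromℕ< lt)} (F-mate-Adj {i} {fromℕ< lt} (Fin.toℕ-fromℕ< lt)))
      (f≤∑f (λ j → a (suc i) (suc j)) (fromℕ< lt))))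

  e-F : ∀ r → e r (F (suc M)) ≡ M ^ r + ∑[ i < M ] (deg (F (suc M)) (suc i) ^ r)
  e-F r = trans (e≡∑ r) (cong (λ k → k ^ r + ∑[ i < M ] (deg (F (suc M)) (suc i) ^ r)) deg-F-0)

open Friendship

e-F-even : ∀ m r → (m * 2) ^ r + m * 2 * 2 ^ r ≤ e r (F (suc (m * 2)))
e-F-even m r = ≤-trans (+-monoʳ-≤ ((m * 2) ^ r) (subst (_≤ ∑[ i < m * 2 ] (deg (F (suc (m * 2))) (suc i) ^ r)) (∑-const (m * 2) (2 ^ r))
    (∑-mono (λ i → ^-monoˡ-≤ r (deg-F≥2 (m * 2) i (mate-< m (toℕ i) (Fin.toℕ<n i)))))))
  (≤-reflexive (≡-sym (e-F (m * 2) r)))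

e-F-odd : ∀ m r → (suc (m * 2)) ^ r + m * 2 * 2 ^ r + 1 ≤ e r (F (suc (suc (m * 2))))
e-F-odd m r = ≤-trans (≤-reflexive (+-assoc (M ^ r) (m * 2 * 2 ^ r) 1))
  (≤-trans (+-monoʳ-≤ (M ^ r) (+-cancelˡ-≤ (2 ^ r) _ _ total)) (≤-reflexive (≡-sym (e-F M r))))
  where
  open ≤-Reasoning
  M : ℕ
  M = suc (m * 2)
  g : Fin M → ℕ
  g i = deg (F (suc M)) (suc i) ^ r
  l : Fin M
  l = fromℕ (m * 2)
  -- At the unmatched vertex `l` the lower bound is 1 instead of `2 ^ r`; the `δ` terms on the two
  -- sides record this exchange without subtraction.
  point : ∀ i → 2 ^ r + δ l i ≤ g i + δ l i * 2 ^ r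
  point i with l Fin.≟ i
  ... | yes refl = ≤-trans (≤-reflexive (+-comm (2 ^ r) (δ l l)))
        (+-mono-≤ (≤-trans (≤-reflexive (trans (δ-refl l) (≡-sym (^-zeroˡ r)))) (^-monoˡ-≤ r (deg-F≥1 M l)))
                  (≤-reflexive (trans (≡-sym (*-identityˡ (2 ^ r))) (cong (_* 2 ^ r) (≡-sym (δ-refl l))))))
  ... | no l≢i = ≤-trans (≤-reflexive (trans (cong (2 ^ r +_) (δ-≢ l≢i)) (+-identityʳ (2 ^ r))))
        (≤-trans (^-monoˡ-≤ r (deg-F≥2 M i (m≤n⇒m≤1+n (mate-< m (toℕ i) i<)))) (m≤m+n _ _))
    where
    i< : toℕ i < m * 2
    i< = ≤∧≢⇒< (≤-pred (Fin.toℕ<n i)) (λ eq → l≢i (Fin.toℕ-injective (trans (Fin.toℕ-fromℕ (m * 2)) (≡-sym eq))))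
  total : 2 ^ r + (m * 2 * 2 ^ r + 1) ≤ 2 ^ r + sum g
  total = begin
    2 ^ r + (m * 2 * 2 ^ r + 1)                        ≡⟨ ≡-sym (+-assoc (2 ^ r) _ 1) ⟩
    M * 2 ^ r + 1                                      ≡⟨ cong₂ _+_ (≡-sym (∑-const M (2 ^ r))) (≡-sym (∑-δ1 l)) ⟩
    ∑[ i < M ] (2 ^ r) + sum (δ l)                     ≡⟨ ≡-sym (∑-distrib-+ (λ (_ : Fin M) → 2 ^ r) (δ l)) ⟩
    ∑[ i < M ] (2 ^ r + δ l i)                         ≤⟨ ∑-mono point ⟩
    ∑[ i < M ] (g i + δ l i * 2 ^ r)                   ≡⟨ ∑-distrib-+ g (λ i → δ l i * 2 ^ r) ⟩
    sum g + ∑[ i < M ] (δ l i * 2 ^ r)                 ≡⟨ cong (sum g +_) (∑-δ l (λ _ → 2 ^ r)) ⟩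
    sum g + 2 ^ r                                      ≡⟨ +-comm (sum g) (2 ^ r) ⟩
    2 ^ r + sum g                                      ∎

halve : ∀ n → ∃ λ m → n ≡ m * 2 ⊎ n ≡ suc (m * 2)
halve zero = 0 , inj₁ refl
halve (suc n) with halve n
... | m , inj₁ refl = m , inj₂ refl
... | m , inj₂ refl = suc m , inj₁ refl

-- One bound for both parities: the `2 ^ r` on the right pays for the vertex that is unmatched when
-- `M` is odd.
e-F≥ : ∀ M r → M ^ r + M * 2 ^ r + 1 ≤ e r (F (suc M)) + 2 ^ r
e-F≥ M r with halve M
... | m , inj₁ refl = +-mono-≤ (e-F-even m r) (m^n>0 2 r)
... | m , inj₂ refl = ≤-trans (≤-reflexive (lem (M ^ r) (2 ^ r) (m * 2 * 2 ^ r))) (+-monoˡ-≤ (2 ^ r) (e-F-odd m r))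
  where
  lem : ∀ p q t → p + (q + t) + 1 ≡ p + t + 1 + q
  lem = solve-∀

-- A vertex adjacent to all others

module Universal {M} (G : Graph (suc M)) (free : ¬ ContainsCycle 4 G) (v : Fin (suc M))
                 (s≡0 : Neighbourhood.s G free v ≡ 0) where

  open C₄-free G free
  open Neighbourhood G free v

  deg-v : deg G v ≡ M
  deg-v = suc-injective (≡-sym (trans n≡1+deg+s (trans (cong (1 + deg G v +_) s≡0) (+-identityʳ _))))

  deg≤2 : ∀ {u} → u ≢ v → deg G u ≤ 2
  deg≤2 {u} u≢v = ≤-trans (deg≤2+degS u≢v) (+-monoʳ-≤ 2 (≤-trans (degS≤s u) (≤-reflexive s≡0)))

  -- Adding `2 ^ r` at `v` on both sides allows a termwise comparison. For even `M` the bound meets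
  -- `e-F-even`.
  e-even : ∀ r → e r G ≤ M ^ r + M * 2 ^ r
  e-even r = +-cancelʳ-≤ (2 ^ r) _ _ (begin
    e r G + 2 ^ r                                                      ≡⟨ cong₂ _+_ (e≡∑ r) (≡-sym (∑-δ v (λ _ → 2 ^ r))) ⟩
    ∑[ u < suc M ] (deg G u ^ r) + ∑[ u < suc M ] (δ v u * 2 ^ r)      ≡⟨ ≡-sym (∑-distrib-+ (λ u → deg G u ^ r) (λ u → δ v u * 2 ^ r)) ⟩
    ∑[ u < suc M ] (deg G u ^ r + δ v u * 2 ^ r)                       ≤⟨ ∑-mono point ⟩
    ∑[ u < suc M ] (δ v u * M ^ r + 2 ^ r)                             ≡⟨ ∑-distrib-+ (λ u → δ v u * M ^ r) (λ _ → 2 ^ r) ⟩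
    ∑[ u < suc M ] (δ v u * M ^ r) + ∑[ u < suc M ] (2 ^ r)            ≡⟨ cong₂ _+_ (∑-δ v (λ _ → M ^ r)) (∑-const (suc M) (2 ^ r)) ⟩
    M ^ r + suc M * 2 ^ r                                              ≡⟨ lem (M ^ r) (2 ^ r) (M * 2 ^ r) ⟩
    M ^ r + M * 2 ^ r + 2 ^ r                                          ∎)
    where
    open ≤-Reasoning
    lem : ∀ p q t → p + (q + t) ≡ p + t + q
    lem = solve-∀
    point : ∀ u → deg G u ^ r + δ v u * 2 ^ r ≤ δ v u * M ^ r + 2 ^ r
    point u with v Fin.≟ u
    ... | yes refl rewrite δ-refl v = ≤-reflexive (cong₂ _+_ (trans (cong (_^ r) deg-v) (≡-sym (*-identityˡ (M ^ r)))) (*-identityˡ (2 ^ r)))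
    ... | no v≢u rewrite δ-≢ v≢u = ≤-trans (≤-reflexive (+-identityʳ _)) (^-monoˡ-≤ r (deg≤2 (v≢u ∘ ≡-sym)))

  -- A vertex of degree at most 1 lowers the bound of `e-even` by `2 ^ r` - 1, which is what `F`
  -- loses when `M` is odd.
  e-leaf : ∀ {w} r → w ≢ v → deg G w ≤ 1 → e r G + 2 ^ r ≤ M ^ r + M * 2 ^ r + 1
  e-leaf {w} r w≢v leaf = +-cancelʳ-≤ (2 ^ r) _ _ (begin
    e r G + 2 ^ r + 2 ^ r                                                   ≡⟨ cong₂ _+_ (cong₂ _+_ (e≡∑ r) (≡-sym (∑-δ v (λ _ → 2 ^ r)))) (≡-sym (∑-δ w (λ _ → 2 ^ r))) ⟩
    ∑[ u < suc M ] (deg G u ^ r) + ∑[ u < suc M ] (δ v u * 2 ^ r) + ∑[ u < suc M ] (δ w u * 2 ^ r)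
                                                                            ≡⟨ ≡-sym (trans (∑-distrib-+ (λ u → deg G u ^ r + δ v u * 2 ^ r) (λ u → δ w u * 2 ^ r))
                                                                                 (cong (_+ ∑[ u < suc M ] (δ w u * 2 ^ r)) (∑-distrib-+ (λ u → deg G u ^ r) (λ u → δ v u * 2 ^ r)))) ⟩
    ∑[ u < suc M ] (deg G u ^ r + δ v u * 2 ^ r + δ w u * 2 ^ r)            ≤⟨ ∑-mono point ⟩
    ∑[ u < suc M ] (δ v u * M ^ r + δ w u + 2 ^ r)                          ≡⟨ trans (∑-distrib-+ (λ u → δ v u * M ^ r + δ w u) (λ _ → 2 ^ r))
                                                                                 (cong (_+ ∑[ u < suc M ] (2 ^ r)) (∑-distrib-+ (λ u → δ v u * M ^ r) (δ w))) ⟩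
    ∑[ u < suc M ] (δ v u * M ^ r) + sum (δ w) + ∑[ u < suc M ] (2 ^ r)     ≡⟨ cong₂ _+_ (cong₂ _+_ (∑-δ v (λ _ → M ^ r)) (∑-δ1 w)) (∑-const (suc M) (2 ^ r)) ⟩
    M ^ r + 1 + suc M * 2 ^ r                                               ≡⟨ lem (M ^ r) (2 ^ r) (M * 2 ^ r) ⟩
    M ^ r + M * 2 ^ r + 1 + 2 ^ r                                           ∎)
    where
    open ≤-Reasoning
    lem : ∀ p q t → p + 1 + (q + t) ≡ p + t + 1 + q
    lem = solve-∀
    point : ∀ u → deg G u ^ r + δ v u * 2 ^ r + δ w u * 2 ^ r ≤ δ v u * M ^ r + δ w u + 2 ^ r
    point u with v Fin.≟ u
    ... | yes refl rewrite δ-refl v | δ-≢ w≢v = ≤-reflexive (trans (+-identityʳ _) (cong₂ _+_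
            (trans (cong (_^ r) deg-v) (≡-sym (trans (+-identityʳ _) (*-identityˡ (M ^ r))))) (*-identityˡ (2 ^ r))))
    ... | no v≢u rewrite δ-≢ v≢u with w Fin.≟ u
    ...   | yes refl rewrite δ-refl w = +-mono-≤ (≤-trans (≤-reflexive (+-identityʳ _))
              (≤-trans (^-monoˡ-≤ r leaf) (≤-reflexive (^-zeroˡ r)))) (≤-reflexive (*-identityˡ (2 ^ r)))
    ...   | no w≢u rewrite δ-≢ w≢u = ≤-trans (≤-reflexive (trans (+-identityʳ _) (+-identityʳ _))) (^-monoˡ-≤ r (deg≤2 (v≢u ∘ ≡-sym)))

  D-2-regular : (∀ u → u ≢ v → 1 < deg G u) → D ≡ M + M * 2
  D-2-regular h = +-cancelʳ-≡ 2 D (M + M * 2) (begin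
    D + 2                                                       ≡⟨ cong (D +_) (≡-sym (∑-δ v (λ _ → 2))) ⟩
    D + ∑[ u < suc M ] (δ v u * 2)                              ≡⟨ ≡-sym (∑-distrib-+ (deg G) (λ u → δ v u * 2)) ⟩
    ∑[ u < suc M ] (deg G u + δ v u * 2)                        ≡⟨ sum-cong-≗ point ⟩
    ∑[ u < suc M ] (δ v u * M + 2)                              ≡⟨ ∑-distrib-+ (λ u → δ v u * M) (λ _ → 2) ⟩
    ∑[ u < suc M ] (δ v u * M) + ∑[ u < suc M ] 2               ≡⟨ cong₂ _+_ (∑-δ v (λ _ → M)) (∑-const (suc M) 2) ⟩
    M + suc M * 2                                               ≡⟨ lem M ⟩
    M + M * 2 + 2                                               ∎)
    where
    open ≡-Reasoning
    lem : ∀ M → M + (1 + M) * 2 ≡ M + M * 2 + 2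
    lem = solve-∀
    point : ∀ u → deg G u + δ v u * 2 ≡ δ v u * M + 2
    point u with v Fin.≟ u
    ... | yes refl rewrite δ-refl v = cong (_+ 2) (trans deg-v (≡-sym (*-identityˡ M)))
    ... | no v≢u rewrite δ-≢ v≢u = trans (+-identityʳ _) (≤-antisym (deg≤2 (v≢u ∘ ≡-sym)) (h u (v≢u ∘ ≡-sym)))

  -- If every vertex other than `v` had degree 2, the degree sum would be 3M, which is odd, against
  -- the handshake lemma.
  leaf-exists : ∀ m → M ≡ suc (m * 2) → ∃ λ w → w ≢ v × deg G w ≤ 1
  leaf-exists m odd with Fin.any? (λ u → ¬? (u Fin.≟ v) ×-dec (deg G u ≤? 1))
  ... | yes found = found
  ... | no none = ⊥-elim (even≢odd (proj₁ D-even) (1 + m * 3)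
          (trans (≡-sym (trans (proj₂ D-even) (cong (proj₁ D-even +_) (≡-sym (+-identityʳ _)))))
          (trans (D-2-regular (λ u u≢v → ≰⇒> (λ le → none (u , u≢v , le))))
          (trans (cong (λ M → M + M * 2) odd) (lem m)))))
    where
    lem : ∀ m → suc (m * 2) + suc (m * 2) * 2 ≡ suc (2 * (1 + m * 3))
    lem = solve-∀

  e≤e-F : ∀ r → e r G ≤ e r (F (suc M))
  e≤e-F r with halve M
  ... | m , inj₁ refl = ≤-trans (e-even r) (e-F-even m r)
  ... | m , inj₂ eq with leaf-exists m eq
  ...   | w , w≢v , leaf = +-cancelʳ-≤ (2 ^ r) _ _ (≤-trans (e-leaf r w≢v leaf) (e-F≥ M r))

-- Degree powers for r ≥ 3

module LargeDegree {M} (G : Graph (suc M)) (free : ¬ ContainsCycle 4 G) (v : Fin (suc M)) where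

  open C₄-free G free
  open Neighbourhood G free v

  M≡deg+s : M ≡ deg G v + s
  M≡deg+s = suc-injective n≡1+deg+s

  -- Missing `s` neighbours costs M² - d² = 2ds + s², at least 19s² because d ≥ 9s. By `Q≤` it
  -- remains to compare this with 6s² + 5s + 7, which is smaller for s ≥ 1. The 4 on the left
  -- matches the `2 ^ r` of `e-F≥`.
  e₂-bound : 1 ≤ s → 10 * s ≤ M → e 2 G + 4 ≤ M ^ 2 + M * 2 ^ 2 + 1
  e₂-bound 1≤s 10s≤M = begin
    e 2 G + 4                                                               ≤⟨ +-monoˡ-≤ 4 (e≤ 2) ⟩
    d ^ 2 + ∑[ u < suc M ] ((2 + degS u) ^ 2) + 4                           ≡⟨ cong (λ k → d ^ 2 + k + 4) (sum-cong-≗ (λ u → cong ((2 + degS u) *_) (*-identityʳ (2 + degS u)))) ⟩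
    d ^ 2 + Q + 4                                                           ≤⟨ +-monoˡ-≤ 4 (+-monoʳ-≤ (d ^ 2) Q≤) ⟩
    d ^ 2 + (suc M * 4 + 5 * (s * (1 + s)) + s * s) + 4                     ≤⟨ arith d s M≡deg+s 1≤s 10s≤M ⟩
    M ^ 2 + M * 2 ^ 2 + 1                                                   ∎
    where
    open ≤-Reasoning
    d : ℕ
    d = deg G v
    -- The slack is displayed as a polynomial with nonnegative coefficients in p = s - 1 and t = d -
    -- 9s.
    lem : ∀ p t → let s = 1 + p ; d = 9 * s + t in
          d * (d * 1) + (suc (d + s) * 4 + 5 * (s * (1 + s)) + s * s) + 4 + (1 + 21 * p + 13 * (p * p) + 2 * t * s)
          ≡ (d + s) * ((d + s) * 1) + (d + s) * 4 + 1
    lem = solve-∀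
    arith : ∀ d s → M ≡ d + s → 1 ≤ s → 10 * s ≤ M →
            d ^ 2 + (suc M * 4 + 5 * (s * (1 + s)) + s * s) + 4 ≤ M ^ 2 + M * 2 ^ 2 + 1
    arith d (suc p) refl (s≤s z≤n) le with m≤n⇒∃[o]m+o≡n {9 * suc p} {d} (+-cancelʳ-≤ (suc p) _ _ (≤-trans (≤-reflexive (+-comm (9 * suc p) (suc p))) le))
    ... | t , refl = ≤-trans (m≤m+n _ _) (≤-reflexive (lem p t))

  -- The main term is at most `d * M ^ (2 + q)`, which falls short of the target by
  -- `s * M ^ (2 + q)`. The other vertices contribute at most `Q` times 3s `M ^ q`, and 3`Q` ≤ M²
  -- fits this into the gap.
  e-bound : ∀ q → 100 ≤ M → 1 ≤ s → 10 * s ≤ M → e (3 + q) G ≤ M ^ (3 + q)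
  e-bound q 100≤M 1≤s 10s≤M = begin
    e (3 + q) G                                                             ≤⟨ e≤ (3 + q) ⟩
    d ^ (3 + q) + ∑[ u < suc M ] ((2 + degS u) ^ (3 + q))                   ≤⟨ +-mono-≤ (*-monoʳ-≤ d (^-monoˡ-≤ (2 + q) d≤M)) (∑-mono point) ⟩
    d * M ^ (2 + q) + ∑[ u < suc M ] ((2 + degS u) * (2 + degS u) * (2 + s) ^ (1 + q))
                                                                            ≡⟨ cong (d * M ^ (2 + q) +_) (≡-sym (*-distribʳ-sum ((2 + s) ^ (1 + q)) (λ u → (2 + degS u) * (2 + degS u)))) ⟩
    d * M ^ (2 + q) + Q * (2 + s) ^ (1 + q)                                 ≤⟨ +-monoʳ-≤ (d * M ^ (2 + q)) (*-monoʳ-≤ Q (*-mono-≤ 2+s≤3s (^-monoˡ-≤ q 2+s≤M))) ⟩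
    d * M ^ (2 + q) + Q * (3 * s * M ^ q)                                   ≡⟨ cong (d * M ^ (2 + q) +_) (rearrange Q s (M ^ q)) ⟩
    d * M ^ (2 + q) + 3 * Q * (s * M ^ q)                                   ≤⟨ +-monoʳ-≤ (d * M ^ (2 + q)) (*-monoˡ-≤ (s * M ^ q) 3Q≤M²) ⟩
    d * M ^ (2 + q) + M * M * (s * M ^ q)                                   ≡⟨ collect d s M (M ^ q) ⟩
    (d + s) * M ^ (2 + q)                                                   ≡⟨ cong (_* M ^ (2 + q)) (≡-sym M≡deg+s) ⟩
    M ^ (3 + q)                                                             ∎
    where
    open ≤-Reasoning
    d : ℕ
    d = deg G v
    d≤M : d ≤ M
    d≤M = subst (d ≤_) (≡-sym M≡deg+s) (m≤m+n d s)
    rearrange : ∀ p q t → p * (3 * q * t) ≡ 3 * p * (q * t)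
    rearrange = solve-∀
    collect : ∀ d s m t → d * (m * (m * t)) + m * m * (s * t) ≡ (d + s) * (m * (m * t))
    collect = solve-∀
    2+s≤3s : 2 + s ≤ 3 * s
    2+s≤3s = ≤-trans (+-monoˡ-≤ s (*-monoʳ-≤ 2 1≤s)) (≤-reflexive (+-comm (2 * s) s))
    2+s≤M : 2 + s ≤ M
    2+s≤M = ≤-trans 2+s≤3s (≤-trans (*-monoˡ-≤ s {3} {10} (s≤s (s≤s (s≤s z≤n)))) 10s≤M)
    point : ∀ u → (2 + degS u) ^ (3 + q) ≤ (2 + degS u) * (2 + degS u) * (2 + s) ^ (1 + q)
    point u = ≤-trans (≤-reflexive (≡-sym (*-assoc (2 + degS u) (2 + degS u) ((2 + degS u) ^ (1 + q)))))
                (*-monoʳ-≤ ((2 + degS u) * (2 + degS u)) (^-monoˡ-≤ (1 + q) (+-monoʳ-≤ 2 (degS≤s u))))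
    100ss≤MM : 100 * (s * s) ≤ M * M
    100ss≤MM = ≤-trans (≤-reflexive (lem s)) (*-mono-≤ 10s≤M 10s≤M)
      where
      lem : ∀ s → 100 * (s * s) ≡ 10 * s * (10 * s)
      lem = solve-∀
    -- 3`Q` is at most 24M + 33s². Since M ≥ 100 and M ≥ 10s, this is at most 57 hundredths of M².
    3Q≤M² : 3 * Q ≤ M * M
    3Q≤M² = *-cancelˡ-≤ 100 (begin
      100 * (3 * Q)                                                    ≤⟨ *-monoʳ-≤ 100 (*-monoʳ-≤ 3 Q≤) ⟩
      100 * (3 * (suc M * 4 + 5 * (s * (1 + s)) + s * s))              ≤⟨ *-monoʳ-≤ 100 (*-monoʳ-≤ 3 (+-monoˡ-≤ (s * s) (+-mono-≤ (*-monoˡ-≤ 4 {suc M} {M + M} (+-monoˡ-≤ M (≤-trans (s≤s z≤n) 100≤M)))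
                                                                            (*-monoʳ-≤ 5 (*-monoʳ-≤ s (+-monoˡ-≤ s 1≤s)))))) ⟩
      100 * (3 * ((M + M) * 4 + 5 * (s * (s + s)) + s * s))            ≡⟨ lem M s ⟩
      24 * (100 * M) + 33 * (100 * (s * s))                            ≤⟨ +-mono-≤ (*-monoʳ-≤ 24 (*-monoˡ-≤ M 100≤M)) (*-monoʳ-≤ 33 100ss≤MM) ⟩
      24 * (M * M) + 33 * (M * M)                                      ≤⟨ m≤m+n _ (43 * (M * M)) ⟩
      24 * (M * M) + 33 * (M * M) + 43 * (M * M)                       ≡⟨ lem′ (M * M) ⟩
      100 * (M * M)                                                    ∎)
      where
      lem : ∀ M s → 100 * (3 * ((M + M) * 4 + 5 * (s * (s + s)) + s * s)) ≡ 24 * (100 * M) + 33 * (100 * (s * s))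
      lem = solve-∀
      lem′ : ∀ x → 24 * x + 33 * x + 43 * x ≡ 100 * x
      lem′ = solve-∀

module SmallDegree {M} (G : Graph (suc M)) (free : ¬ ContainsCycle 4 G) (300≤M : 300 ≤ M) where

  open C₄-free G free

  private
    n SQ : ℕ
    n  = suc M
    SQ = ∑[ u < n ] (deg G u * deg G u)

  -- `D-small` with K = 16 bounds 32`D` by the square sum plus 256n; inserting this into 32 times
  -- `∑deg²≤` eliminates `D`.
  31∑deg²≤ : 31 * SQ ≤ 32 * (n * n) + n * 256
  31∑deg²≤ = +-cancelʳ-≤ SQ _ _ (begin
    31 * SQ + SQ                          ≡⟨ +-comm (31 * SQ) SQ ⟩
    32 * SQ                               ≤⟨ *-monoʳ-≤ 32 ∑deg²≤ ⟩
    32 * (n * n + D)                      ≡⟨ *-distribˡ-+ 32 (n * n) D ⟩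
    32 * (n * n) + 32 * D                 ≤⟨ +-monoʳ-≤ (32 * (n * n)) (D-small 16) ⟩
    32 * (n * n) + (SQ + n * 256)         ≡⟨ lem (32 * (n * n)) SQ (n * 256) ⟩
    32 * (n * n) + n * 256 + SQ           ∎)
    where
    open ≤-Reasoning
    lem : ∀ p q t → p + (q + t) ≡ p + t + q
    lem = solve-∀

  9∑deg²≤ : 9 * SQ ≤ 10 * (M * M)
  9∑deg²≤ = *-cancelˡ-≤ 31 (begin
    31 * (9 * SQ)                                          ≡⟨ swap SQ ⟩
    9 * (31 * SQ)                                          ≤⟨ *-monoʳ-≤ 9 31∑deg²≤ ⟩
    9 * (32 * (n * n) + n * 256)                           ≡⟨ expand M ⟩
    288 * (M * M) + (2880 * M + 2592 * 1)                  ≤⟨ +-monoʳ-≤ (288 * (M * M)) (+-monoʳ-≤ (2880 * M) (*-monoʳ-≤ 2592 (≤-trans (s≤s z≤n) 300≤M))) ⟩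
    288 * (M * M) + (2880 * M + 2592 * M)                  ≤⟨ +-monoʳ-≤ (288 * (M * M)) (m≤m+n _ (1128 * M)) ⟩
    288 * (M * M) + (2880 * M + 2592 * M + 1128 * M)       ≡⟨ collect (M * M) M ⟩
    288 * (M * M) + 22 * (300 * M)                         ≤⟨ +-monoʳ-≤ (288 * (M * M)) (*-monoʳ-≤ 22 (*-monoˡ-≤ M 300≤M)) ⟩
    288 * (M * M) + 22 * (M * M)                           ≡⟨ total (M * M) ⟩
    31 * (10 * (M * M))                                    ∎)
    where
    open ≤-Reasoning
    swap : ∀ x → 31 * (9 * x) ≡ 9 * (31 * x)
    swap = solve-∀
    expand : ∀ M → 9 * (32 * (suc M * suc M) + suc M * 256) ≡ 288 * (M * M) + (2880 * M + 2592 * 1)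
    expand = solve-∀
    collect : ∀ x M → 288 * x + (2880 * M + 2592 * M + 1128 * M) ≡ 288 * x + 22 * (300 * M)
    collect = solve-∀
    total : ∀ x → 288 * x + 22 * x ≡ 31 * (10 * x)
    total = solve-∀

  -- All but two of the factors of each power are bounded by `Δ`. One of them supplies 9/10, which
  -- cancels the 10/9 from `9∑deg²≤`.
  e-bound : ∀ q Δ → (∀ u → deg G u ≤ Δ) → 10 * Δ ≤ 9 * M → e (3 + q) G ≤ M ^ (3 + q)
  e-bound q Δ deg≤Δ 10Δ≤9M = *-cancelˡ-≤ 90 (begin
    90 * e (3 + q) G                                       ≡⟨ cong (90 *_) (e≡∑ (3 + q)) ⟩
    90 * ∑[ u < n ] (deg G u ^ (3 + q))                    ≤⟨ *-monoʳ-≤ 90 (∑-mono point) ⟩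
    90 * ∑[ u < n ] (deg G u * deg G u * Δ ^ (1 + q))      ≡⟨ cong (90 *_) (≡-sym (*-distribʳ-sum (Δ ^ (1 + q)) (λ u → deg G u * deg G u))) ⟩
    90 * (SQ * (Δ * Δ ^ q))                                ≡⟨ lem SQ Δ (Δ ^ q) ⟩
    9 * SQ * (10 * Δ * Δ ^ q)                              ≤⟨ *-mono-≤ 9∑deg²≤ (*-mono-≤ 10Δ≤9M (^-monoˡ-≤ q Δ≤M)) ⟩
    10 * (M * M) * (9 * M * M ^ q)                         ≡⟨ lem′ M (M ^ q) ⟩
    90 * M ^ (3 + q)                                       ∎)
    where
    open ≤-Reasoning
    lem : ∀ x d p → 90 * (x * (d * p)) ≡ 9 * x * (10 * d * p)
    lem = solve-∀
    lem′ : ∀ m p → 10 * (m * m) * (9 * m * p) ≡ 90 * (m * (m * (m * p)))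
    lem′ = solve-∀
    Δ≤M : Δ ≤ M
    Δ≤M = *-cancelˡ-≤ 10 (≤-trans 10Δ≤9M (*-monoˡ-≤ M {9} {10} (n≤1+n 9)))
    point : ∀ u → deg G u ^ (3 + q) ≤ deg G u * deg G u * Δ ^ (1 + q)
    point u = ≤-trans (≤-reflexive (≡-sym (*-assoc (deg G u) (deg G u) (deg G u ^ (1 + q)))))
                (*-monoʳ-≤ (deg G u * deg G u) (^-monoˡ-≤ (1 + q) (deg≤Δ u)))

M^r≤e-F : ∀ M r → M ^ r ≤ e r (F (suc M))
M^r≤e-F M r = subst (M ^ r ≤_) (≡-sym (Friendship.e-F M r)) (m≤m+n _ _)

e₃₊-max : ∀ {M} q → 300 ≤ M → (G : Graph (suc M)) → ¬ ContainsCycle 4 G → e (3 + q) G ≤ e (3 + q) (F (suc M))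
e₃₊-max {M} q 300≤M G free with argmax (deg G)
... | v , max with Neighbourhood.s G free v in eq
...   | zero  = Universal.e≤e-F G free v eq (3 + q)
...   | suc p = ≤-trans bound (M^r≤e-F M (3 + q))
  where
  open Neighbourhood G free v
  1≤s : 1 ≤ s
  1≤s = subst (1 ≤_) (≡-sym eq) (s≤s z≤n)
  bound : e (3 + q) G ≤ M ^ (3 + q)
  bound with 10 * s ≤? M
  ... | yes 10s≤M = LargeDegree.e-bound G free v q (≤-trans (m≤m+n 100 200) 300≤M) 1≤s 10s≤M
  -- Since M = d + s, from 10s ≥ M it follows that 10d ≤ 9M.
  ... | no  10s≰M = SmallDegree.e-bound G free 300≤M q (deg G v) max (+-cancelʳ-≤ M _ _ (begin
    10 * deg G v + M             ≤⟨ +-monoʳ-≤ (10 * deg G v) (≰⇒≥ 10s≰M) ⟩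
    10 * deg G v + 10 * s        ≡⟨ ≡-sym (*-distribˡ-+ 10 (deg G v) s) ⟩
    10 * (deg G v + s)           ≡⟨ cong (10 *_) (≡-sym (LargeDegree.M≡deg+s G free v)) ⟩
    10 * M                       ≡⟨ +-comm M (9 * M) ⟩
    9 * M + M                    ∎))
    where open ≤-Reasoning

-- Even cycles in graphs of small maximum degree

-- Degrees are at most n/c and there are at most n²/c² bad pairs. Up to `ℓ` closed neighbourhoods
-- must be avoided, each of size at most 1 + n/c, and `room` says that these together with further
-- exclusions of total size 4n/c do not exhaust the vertices.
module Greedy {n} (G : Graph n) (free : ¬ ContainsCycle 4 G) (c ℓ : ℕ)
              (c*deg≤n : ∀ u → c * deg G u ≤ n)
              (c²∑b≤n² : c * c * sum (Deficiency.b G free) ≤ n * n)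
              (room : (4 + ℓ) * n + ℓ * c < c * n) where

  open C₄-free G free
  open Deficiency G free

  private
    instance
      n-nonZero : NonZero n
      n-nonZero = >-nonZero (n>0 n room)
        where
        n>0 : ∀ m → (4 + ℓ) * m + ℓ * c < c * m → 0 < m
        n>0 zero    p with ≤-trans p (≤-reflexive (*-zeroʳ c))
        ... | ()
        n>0 (suc m) _ = s≤s z≤n

  heavy : Fin n → ℕ
  heavy y with c * b y ≤? n
  ... | yes _ = 0
  ... | no  _ = 1

  heavy*n≤ : ∀ y → heavy y * n ≤ c * b y
  heavy*n≤ y with c * b y ≤? n
  ... | yes _ = z≤n
  ... | no cb≰n = ≤-trans (≤-reflexive (*-identityˡ n)) (≰⇒≥ cb≰n)

  heavy≡0⇒ : ∀ {y} → heavy y ≡ 0 → c * b y ≤ n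
  heavy≡0⇒ {y} p with c * b y ≤? n
  ... | yes le = le

  -- Markov's inequality: each heavy vertex has at least n/c bad partners, out of n²/c² in total.
  c∑heavy≤n : c * sum heavy ≤ n
  c∑heavy≤n = *-cancelʳ-≤ _ _ n (begin
    c * sum heavy * n                       ≡⟨ *-assoc c (sum heavy) n ⟩
    c * (sum heavy * n)                     ≡⟨ cong (c *_) (*-distribʳ-sum n heavy) ⟩
    c * ∑[ y < n ] (heavy y * n)            ≤⟨ *-monoʳ-≤ c (∑-mono heavy*n≤) ⟩
    c * ∑[ y < n ] (c * b y)                ≡⟨ cong (c *_) (≡-sym (*-distribˡ-sum c b)) ⟩
    c * (c * sum b)                         ≡⟨ ≡-sym (*-assoc c c (sum b)) ⟩
    c * c * sum b                           ≤⟨ c²∑b≤n² ⟩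
    n * n                                   ∎)
    where open ≤-Reasoning

  -- Counts, with multiplicity, the closed neighbourhoods of listed vertices that contain `y`.
  -- Overlaps do no harm, since only its vanishing is used.
  near : ∀ {m} → Vec (Fin n) m → Fin n → ℕ
  near []       y = 0
  near (u ∷ us) y = (δ u y + a u y) + near us y

  c∑near≤ : ∀ {m} (us : Vec (Fin n) m) → c * sum (near us) ≤ m * (c + n)
  c∑near≤ [] = ≤-reflexive (trans (cong (c *_) (sum-replicate-zero n)) (*-zeroʳ c))
  c∑near≤ {suc m} (u ∷ us) = begin
    c * sum (near (u ∷ us))                                  ≡⟨ cong (c *_) (trans (∑-distrib-+ (λ y → δ u y + a u y) (near us))
                                                                  (cong (_+ sum (near us)) (trans (∑-distrib-+ (δ u) (a u)) (cong₂ _+_ (∑-δ1 u) (≡-sym (deg≡∑ u)))))) ⟩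
    c * (1 + deg G u + sum (near us))                        ≡⟨ lem c (deg G u) (sum (near us)) ⟩
    c + c * deg G u + c * sum (near us)                      ≤⟨ +-mono-≤ (+-monoʳ-≤ c (c*deg≤n u)) (c∑near≤ us) ⟩
    c + n + m * (c + n)                                      ∎
    where
    open ≤-Reasoning
    lem : ∀ c d s → c * (1 + d + s) ≡ c + c * d + c * s
    lem = solve-∀

  Fresh : Fin n → Fin n → Set
  Fresh y u = u ≢ y × ¬ Adj G u y

  near≡0⇒Fresh : ∀ {m y} (us : Vec (Fin n) m) → near us y ≡ 0 → All (Fresh y) us
  near≡0⇒Fresh []       p = []
  near≡0⇒Fresh {y = y} (u ∷ us) p =
    (δ≡0⇒≢ (m+n≡0⇒m≡0 (δ u y) pu) , λ uy → 1≢0 (trans (≡-sym (Adj⇒a≡1 uy)) (m+n≡0⇒n≡0 (δ u y) pu)))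
    ∷ near≡0⇒Fresh us (m+n≡0⇒n≡0 (δ u y + a u y) p)
    where
    pu : δ u y + a u y ≡ 0
    pu = m+n≡0⇒m≡0 (δ u y + a u y) p
    1≢0 : 1 ≢ 0
    1≢0 ()

  choose : ∀ {m} (us : Vec (Fin n) m) (f : Fin n → ℕ) → m ≤ ℓ → c * sum f ≤ 4 * n →
           ∃ λ y → f y ≡ 0 × All (Fresh y) us
  choose {m} us f m≤ℓ c∑f≤4n with ∑<n⇒∃0 (λ y → f y + near us y) (*-cancelˡ-< c _ _ few)
    where
    open ≤-Reasoning
    lem : ∀ c l n → 4 * n + l * (c + n) ≡ (4 + l) * n + l * c
    lem = solve-∀
    few : c * ∑[ y < n ] (f y + near us y) < c * n
    few = begin-strict
      c * ∑[ y < n ] (f y + near us y)        ≡⟨ cong (c *_) (∑-distrib-+ f (near us)) ⟩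
      c * (sum f + sum (near us))             ≡⟨ *-distribˡ-+ c (sum f) (sum (near us)) ⟩
      c * sum f + c * sum (near us)           ≤⟨ +-mono-≤ c∑f≤4n (≤-trans (c∑near≤ us) (*-monoˡ-≤ (c + n) m≤ℓ)) ⟩
      4 * n + ℓ * (c + n)                     ≡⟨ lem c ℓ n ⟩
      (4 + ℓ) * n + ℓ * c                     <⟨ room ⟩
      c * n                                   ∎
  ... | y , p = y , m+n≡0⇒m≡0 (f y) p , near≡0⇒Fresh us (m+n≡0⇒n≡0 (f y) p)

  bad≡0⇒common : ∀ {x y} → bad x y ≡ 0 → ∃ λ z → Adj G z x × Adj G z y
  bad≡0⇒common p = codeg>0⇒common (m∸n≡0⇒m≤n p)

  fresh-≢ : ∀ {m y z} {us : Vec (Fin n) m} → All (Fresh y) us → Adj G z y → All (z ≢_) us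
  fresh-≢ {y = y} fr zy = All.map (λ f z≡u → proj₂ f (subst (λ z → Adj G z y) z≡u zy)) fr

  -- Freshness serves twice: `y` is new, and since `y` has no neighbour on the path, its common
  -- neighbour `z` with `h` is new as well.
  bridge : ∀ {m x y h} {ys : Vec (Fin n) m} → Path x (h ∷ ys) → All (Fresh y) (h ∷ ys) → bad h y ≡ 0 →
           ∃ λ z → Adj G z h × Adj G z y × Path x (y ∷ z ∷ h ∷ ys)
  bridge {y = y} P fr p with bad≡0⇒common p
  ... | z , zh , zy = z , zh , zy ,
        (y ∷⟨ Adj-sym zy , Adj⇒≢ (Adj-sym zy) ∷ All.map (λ f y≡u → proj₁ f (≡-sym y≡u)) fr ⟩
         z ∷⟨ zh , fresh-≢ fr zy ⟩ P)

  Light : Fin n → Set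
  Light y = c * b y ≤ n

  start : ∃ Light
  start = let x , p , _ = choose [] heavy z≤n (≤-trans c∑heavy≤n (m≤m+n n _)) in x , heavy≡0⇒ p

  extend : ∀ {m x h} {ys : Vec (Fin n) m} → suc m ≤ ℓ → Light h → Path x (h ∷ ys) →
           ∃ λ y → ∃ λ z → Light y × Path x (y ∷ z ∷ h ∷ ys)
  extend {h = h} {ys} m<ℓ lh P =
    let y , p , fr     = choose (h ∷ ys) (λ y → heavy y + bad h y) m<ℓ few
        z , _ , _ , P′ = bridge P fr (m+n≡0⇒n≡0 (heavy y) p)
    in  y , z , heavy≡0⇒ (m+n≡0⇒m≡0 (heavy y) p) , P′
    where
    open ≤-Reasoning
    few : c * ∑[ y < n ] (heavy y + bad h y) ≤ 4 * n
    few = begin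
      c * ∑[ y < n ] (heavy y + bad h y)      ≡⟨ cong (c *_) (∑-distrib-+ heavy (bad h)) ⟩
      c * (sum heavy + b h)                   ≡⟨ *-distribˡ-+ c (sum heavy) (b h) ⟩
      c * sum heavy + c * b h                 ≤⟨ +-mono-≤ c∑heavy≤n lh ⟩
      n + n                                   ≤⟨ +-monoʳ-≤ n (m≤m+n n _) ⟩
      4 * n                                   ∎

  -- Each step adds two vertices. Only the path before the last step has to be avoided, so its own
  -- length may exceed `ℓ` by 2.
  build : ∀ {x} → Light x → ∀ j → 1 + j * 2 ≤ 2 + ℓ →
          ∃ λ h → ∃ λ (ys : Vec (Fin n) (j * 2)) → Light h × Path x (h ∷ ys)
  build {x} lx zero    _  = x , [] , lx , [-]
  build {x} lx (suc j) le =
    let h , ys , lh , P = build lx j (≤-trans (m≤n+m _ 2) le)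
        y , z , ly , P′ = extend (≤-pred (≤-pred le)) lh P
    in  y , z ∷ h ∷ ys , ly , P′

  -- shared h x y = 0 makes the common neighbours of y with h and of y with x distinct.
  shared : Fin n → Fin n → Fin n → ℕ
  shared h x y = ∑[ z < n ] (a z h * a z x * a z y)

  shared≡0⇒ : ∀ {h x y z} → shared h x y ≡ 0 → Adj G z h → Adj G z x → Adj G z y → ⊥
  shared≡0⇒ {h} {x} {y} {z} p zh zx zy = 1≰0 (≤-trans (≤-reflexive (≡-sym (cong₂ _*_ (cong₂ _*_ (Adj⇒a≡1 zh) (Adj⇒a≡1 zx)) (Adj⇒a≡1 zy))))
    (≤-trans (f≤∑f (λ z → a z h * a z x * a z y) z) (≤-reflexive p)))
    where
    1≰0 : 1 ≤ 0 → ⊥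
    1≰0 ()

  -- Distinct `h` and `x` have at most one common neighbour, and it has at most n/c neighbours `y`.
  c∑shared≤n : ∀ {h x} → h ≢ x → c * sum (shared h x) ≤ n
  c∑shared≤n {h} {x} h≢x = begin
    c * ∑[ y < n ] ∑[ z < n ] (a z h * a z x * a z y)        ≡⟨ cong (c *_) (trans (∑-comm {n} {n} (λ y z → a z h * a z x * a z y))
                                                                  (sum-cong-≗ (λ z → trans (≡-sym (*-distribˡ-sum (a z h * a z x) (a z))) (cong (a z h * a z x *_) (≡-sym (deg≡∑ z)))))) ⟩
    c * ∑[ z < n ] (a z h * a z x * deg G z)                 ≡⟨ *-distribˡ-sum c (λ z → a z h * a z x * deg G z) ⟩
    ∑[ z < n ] (c * (a z h * a z x * deg G z))               ≤⟨ ∑-mono (λ z → ≤-trans (≤-reflexive (lem c (a z h * a z x) (deg G z))) (*-monoʳ-≤ (a z h * a z x) (c*deg≤n z))) ⟩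
    ∑[ z < n ] (a z h * a z x * n)                           ≡⟨ ≡-sym (*-distribʳ-sum n (λ z → a z h * a z x)) ⟩
    codeg h x * n                                            ≤⟨ *-monoˡ-≤ n (codeg≤1 h≢x) ⟩
    1 * n                                                    ≡⟨ *-identityˡ n ⟩
    n                                                        ∎
    where
    open ≤-Reasoning
    lem : ∀ p q r → p * (q * r) ≡ q * (p * r)
    lem = solve-∀

  -- A fresh `y` is joined to `h` through `z` and to `x` through `w`; making `shared` vanish forces
  -- `w` and `z` apart. The three new vertices complete the cycle.
  close : ∀ {m x h} {ys : Vec (Fin n) m} → suc m ≤ ℓ → h ≢ x → Light x → Light h → Path x (h ∷ ys) →
          ContainsCycle (4 + m) G
  close {m} {x} {h} {ys} m<ℓ h≢x lx lh P =
    let y , p , fr       = choose (h ∷ ys) (λ y → bad h y + bad x y + shared h x y) m<ℓ few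
        q                = m+n≡0⇒m≡0 (bad h y + bad x y) p
        z , zh , zy , P′ = bridge P fr (m+n≡0⇒m≡0 (bad h y) q)
        w , wx , wy      = bad≡0⇒common (m+n≡0⇒n≡0 (bad h y) q)
        w≢z              = λ w≡z → shared≡0⇒ (m+n≡0⇒n≡0 (bad h y + bad x y) p) zh
                             (subst (λ w → Adj G w x) w≡z wx) zy
    in  closedPath (w ∷⟨ wy , Adj⇒≢ wy ∷ w≢z ∷ fresh-≢ fr wy ⟩ P′) (Adj-sym wx)
    where
    open ≤-Reasoning
    lem : ∀ n → n + n + n + n ≡ 4 * n
    lem = solve-∀
    few : c * ∑[ y < n ] (bad h y + bad x y + shared h x y) ≤ 4 * n
    few = begin
      c * ∑[ y < n ] (bad h y + bad x y + shared h x y)      ≡⟨ cong (c *_) (trans (∑-distrib-+ (λ y → bad h y + bad x y) (shared h x))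
                                                                  (cong (_+ sum (shared h x)) (∑-distrib-+ (bad h) (bad x)))) ⟩
      c * (b h + b x + sum (shared h x))                     ≡⟨ trans (*-distribˡ-+ c (b h + b x) (sum (shared h x)))
                                                                  (cong (_+ c * sum (shared h x)) (*-distribˡ-+ c (b h) (b x))) ⟩
      c * b h + c * b x + c * sum (shared h x)               ≤⟨ +-mono-≤ (+-mono-≤ lh lx) (c∑shared≤n h≢x) ⟩
      n + n + n                                              ≤⟨ m≤m+n (n + n + n) n ⟩
      n + n + n + n                                          ≡⟨ lem n ⟩
      4 * n                                                  ∎

  cycle : ∀ t → 3 + t * 2 ≤ ℓ → ContainsCycle (6 + t * 2) G
  cycle t le =
    let x , lx          = start
        -- This path has 3 + 2t vertices, and `close` adds three. It is not a single vertex, so its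
        -- ends differ.
        h , ys , lh , P = build lx (suc t) (≤-trans le (m≤n+m ℓ 2))
    in  close le (Path-start≢end P) lx lh P

-- The upper bound for r = 2

e₂-max : ∀ t c {M} → 28 + t * 2 ≤ c → (1 + c * c) * (1 + c * c) ≤ M →
         (G : Graph (suc M)) → ¬ ContainsCycle 4 G → ¬ ContainsCycle (6 + t * 2) G → e 2 G ≤ e 2 (F (suc M))
e₂-max t c {M} 28+2t≤c K²≤M G free free′ with argmax (deg G)
... | v , max with Neighbourhood.s G free v in eq
...   | zero  = Universal.e≤e-F G free v eq 2
...   | suc p with 10 * Neighbourhood.s G free v ≤? M | e 2 G ≤? e 2 (F (suc M))
...     | yes 10s≤M | _ = +-cancelʳ-≤ 4 _ _ (≤-trans (LargeDegree.e₂-bound G free v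
                            (subst (1 ≤_) (≡-sym eq) (s≤s z≤n)) 10s≤M) (e-F≥ M 2))
...     | no _ | yes done = done
...     | no 10s≰M | no e≰ = ⊥-elim (absurd (c * deg G v ≤? n))
  where
  open C₄-free G free
  open Deficiency G free
  open Neighbourhood G free v using (s)
  open ≤-Reasoning
  n K SQ : ℕ
  n = suc M
  K = 1 + c * c
  SQ = ∑[ u < n ] (deg G u * deg G u)
  K²≤n : K * K ≤ n
  K²≤n = ≤-trans K²≤M (n≤1+n M)
  20≤c : 20 ≤ c
  20≤c = ≤-trans (m≤m+n 20 (8 + t * 2)) 28+2t≤c
  instance
    c-nonZero : NonZero c
    c-nonZero = >-nonZero (≤-trans (s≤s z≤n) 20≤c)
  c≤c² : c ≤ c * c
  c≤c² = m≤m*n c c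
  c²≤M : c * c ≤ M
  c²≤M = ≤-trans (≤-trans (n≤1+n (c * c)) (m≤m*n K K)) K²≤M
  2≤M : 2 ≤ M
  2≤M = ≤-trans (≤-trans (≤-trans (m≤m+n 2 18) 20≤c) c≤c²) c²≤M
  e₂≡SQ : e 2 G ≡ SQ
  e₂≡SQ = trans (e≡∑ 2) (sum-cong-≗ (λ u → cong (deg G u *_) (*-identityʳ (deg G u))))
  -- By `e-F≥`, `e 2 (F n)` is at least M² + 4M - 3 = n² + 2M - 4, hence at least n² once M ≥ 2; a
  -- counterexample `G` inherits this.
  n²≤SQ : n * n ≤ SQ
  n²≤SQ = +-cancelʳ-≤ 4 _ _ (begin
    n * n + 4                          ≤⟨ +-monoʳ-≤ (n * n) (*-monoʳ-≤ 2 2≤M) ⟩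
    n * n + 2 * M                      ≡⟨ lem M ⟩
    M ^ 2 + M * 2 ^ 2 + 1              ≤⟨ e-F≥ M 2 ⟩
    e 2 (F n) + 4                      ≤⟨ +-monoˡ-≤ 4 (≰⇒≥ e≰) ⟩
    e 2 G + 4                          ≡⟨ cong (_+ 4) e₂≡SQ ⟩
    SQ + 4                             ∎)
    where
    lem : ∀ M → (1 + M) * (1 + M) + 2 * M ≡ M * (M * 1) + M * 4 + 1
    lem = solve-∀
  ∑b≤D : sum b ≤ D
  ∑b≤D = +-cancelˡ-≤ (n * n) _ _ (≤-trans (+-monoˡ-≤ (sum b) n²≤SQ) ∑b≤)
  -- `D-small` at K = 1 + c² with K² ≤ n gives 2K`D` ≤ 2n² + `D`. The excess of 2K over 2c² absorbs
  -- the last term.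
  c²D≤n² : c * c * D ≤ n * n
  c²D≤n² = *-cancelˡ-≤ 2 (+-cancelʳ-≤ D _ _ (begin
    2 * (c * c * D) + D                ≤⟨ m≤m+n _ D ⟩
    2 * (c * c * D) + D + D            ≡⟨ lem (c * c) D ⟩
    (K + K) * D                        ≤⟨ D-small K ⟩
    SQ + n * (K * K)                   ≤⟨ +-mono-≤ ∑deg²≤ (*-monoʳ-≤ n K²≤n) ⟩
    n * n + D + n * n                  ≡⟨ lem′ (n * n) D ⟩
    2 * (n * n) + D                    ∎))
    where
    lem : ∀ q D → 2 * (q * D) + D + D ≡ ((1 + q) + (1 + q)) * D
    lem = solve-∀
    lem′ : ∀ q D → q + D + q ≡ 2 * q + D
    lem′ = solve-∀
  absurd : Dec (c * deg G v ≤ n) → ⊥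
  absurd (yes cd≤n) = free′ (Greedy.cycle G free c (3 + t * 2)
      (λ u → ≤-trans (*-monoʳ-≤ c (max u)) cd≤n) (≤-trans (*-monoʳ-≤ (c * c) ∑b≤D) c²D≤n²) room t ≤-refl)
    where
    -- Since ℓ ≤ c and c² < n, the term ℓc costs less than one further `n`; the constant 28 leaves
    -- ample space for 8 + 2t.
    room : (4 + (3 + t * 2)) * n + (3 + t * 2) * c < c * n
    room = begin-strict
      (7 + t * 2) * n + (3 + t * 2) * c         ≤⟨ +-monoʳ-≤ ((7 + t * 2) * n) (*-monoˡ-≤ c (≤-trans (+-monoˡ-≤ (t * 2) (m≤m+n 3 25)) 28+2t≤c)) ⟩
      (7 + t * 2) * n + c * c                   <⟨ +-monoʳ-< ((7 + t * 2) * n) (s≤s c²≤M) ⟩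
      (7 + t * 2) * n + n                       ≤⟨ m≤m+n _ (20 * n) ⟩
      (7 + t * 2) * n + n + 20 * n              ≡⟨ lem (t * 2) n ⟩
      (28 + t * 2) * n                          ≤⟨ *-monoˡ-≤ n 28+2t≤c ⟩
      c * n                                     ∎
      where
      lem : ∀ x n → (7 + x) * n + n + 20 * n ≡ (28 + x) * n
      lem = solve-∀
  -- Both 10s ≥ n and cd > n hold here, so n² < 10s · cd, while `s*deg≤` bounds the product by
  -- 20c`D`, which is at most c²`D` ≤ n². This is where c ≥ 20 enters.
  absurd (no cd≰n) = <-irrefl refl (begin-strict
    n * n                              <⟨ *-monoʳ-< n (≰⇒> cd≰n) ⟩
    n * (c * deg G v)                  ≤⟨ *-monoˡ-≤ (c * deg G v) (≰⇒> 10s≰M) ⟩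
    10 * s * (c * deg G v)             ≡⟨ lem s c (deg G v) ⟩
    10 * c * (s * deg G v)             ≤⟨ *-monoʳ-≤ (10 * c) (s*deg≤ v) ⟩
    10 * c * (D + sum b)               ≤⟨ *-monoʳ-≤ (10 * c) (+-monoʳ-≤ D ∑b≤D) ⟩
    10 * c * (D + D)                   ≡⟨ lem′ c D ⟩
    20 * c * D                         ≤⟨ *-monoˡ-≤ D (*-monoˡ-≤ c 20≤c) ⟩
    c * c * D                          ≤⟨ c²D≤n² ⟩
    n * n                              ∎)
    where
    lem : ∀ s c d → 10 * s * (c * d) ≡ 10 * c * (s * d)
    lem = solve-∀
    lem′ : ∀ c D → 10 * c * (D + D) ≡ 20 * c * D
    lem′ = solve-∀

theorem1p6 : (∀ (r : ℕ) → 3 ≤ r →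
    Σ ℕ λ N → ∀ (n : ℕ) → N ≤ n →
    IsMaxE r n (λ G → ¬ ContainsCycle 4 G) (e r (F n)))
    ×
    (∀ (k : ℕ) → 2 < k →
    Σ ℕ λ N → ∀ (n : ℕ) → N ≤ n →
    IsMaxE 2 n (λ G → ¬ ContainsCycle 4 G × ¬ ContainsCycle (2 * k) G) (e 2 (F n)))
theorem1p6 = partᵢᵢ , partᵢᵢᵢ
  where
  partᵢᵢ : ∀ r → 3 ≤ r → Σ ℕ λ N → ∀ n → N ≤ n →
           IsMaxE r n (λ G → ¬ ContainsCycle 4 G) (e r (F n))
  partᵢᵢ (suc (suc (suc q))) (s≤s (s≤s (s≤s z≤n))) = 301 , λ
    { (suc M) (s≤s 300≤M) → (F (suc M) , Friendship.F-C₄-free M , refl) , e₃₊-max q 300≤M }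
  partᵢᵢᵢ : ∀ k → 2 < k → Σ ℕ λ N → ∀ n → N ≤ n →
            IsMaxE 2 n (λ G → ¬ ContainsCycle 4 G × ¬ ContainsCycle (2 * k) G) (e 2 (F n))
  -- Writing k = 3 + t turns the forbidden length into 6 + 2t, and the threshold ensures M ≥ (1 +
  -- c²)² for the smallest `c` that `e₂-max` admits.
  partᵢᵢᵢ (suc (suc (suc t))) (s≤s (s≤s (s≤s z≤n))) = suc ((1 + c * c) * (1 + c * c)) , λ
    { (suc M) (s≤s K²≤M) →
        (F (suc M) , (Friendship.F-C₄-free M , Friendship.F-C₆₊-free M (t * 2) ∘ subst (λ ℓ → ContainsCycle ℓ (F (suc M))) 2k≡)
          , refl)
        , λ G free → e₂-max t c ≤-refl K²≤M G (proj₁ free) (proj₂ free ∘ subst (λ ℓ → ContainsCycle ℓ G) (≡-sym 2k≡)) }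
    where
    c : ℕ
    c = 28 + t * 2
    2k≡ : 2 * (3 + t) ≡ 6 + t * 2
    2k≡ = *-comm 2 (3 + t)
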